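{- For every integer $h\geq 1$, there is a planar poset $P$ of height $h$ with $\dim(P) \geq (4/3)h-2$.
   Context: All posets are finite. The height of a poset is the maximum size of a chain in it. The dimension $\dim(P)$ of a poset $P$ is the least integer $d$ such that $P$ is the intersection of $d$ linear orders. A cover relation of $P$ is a relation $a\leq b$ in $P$ with $a\neq b$ such that there is no element $c$ distinct from $a,b$ with $a\leq c\leq b$ in $P$. A diagram of $P$ is a drawing in the plane in which elements are distinct points and each cover relation $a\leq b$ is represented by a curve from $a$ to $b$ going upwards (i.e. strictly increasing in the $y$-coordinate). A poset is planar if it has a diagram drawn in a planar way (without crossings: curves meet only at common endpoints, and no curve passes through a point representing an element other than its endpoints). -}

module Defs where

open import Data.Fin.Base using (Fin)
open import Data.Nat.Base as ℕ using (ℕ)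
open import Data.Product using (Σ-syntax; ∃; ∃-syntax; _×_; _,_; proj₁; proj₂)
open import Data.Rational.Base as ℚ using (ℚ; 0ℚ; 1ℚ)
import Data.Rational.Properties as ℚₚ
open import Data.Sum.Base using (_⊎_; inj₁; inj₂)
open import Function.Bundles using (_↔_; _⇔_; mk⇔)
open import Function.Definitions using (Injective)
open import Level using (0ℓ) renaming (suc to lsuc)
open import Relation.Binary.Core using (Rel)
open import Relation.Binary.Definitions using (tri<; tri≈; tri>)
open import Relation.Binary.PropositionalEquality using (_≡_; _≢_; subst)
open import Relation.Binary.Structures using (IsPartialOrder; IsTotalOrder)
open import Relation.Nullary.Negation using (¬_)
open import Relation.Unary using (Pred)

-- Real numbers as two-sided Dedekind cuts:
-- Lower q means q < x, and Upper q means x < q.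

record ℝ : Set₁ where
  field
    Lower Upper     : Pred ℚ 0ℓ
    lower-inhabited : ∃ Lower
    upper-inhabited : ∃ Upper
    lower-rounded   : ∀ q → Lower q ⇔ (∃[ r ] (q ℚ.< r × Lower r))
    upper-rounded   : ∀ q → Upper q ⇔ (∃[ r ] (r ℚ.< q × Upper r))
    disjoint        : ∀ q → ¬ (Lower q × Upper q)
    located         : ∀ q r → q ℚ.< r → Lower q ⊎ Upper r

open ℝ public using (Lower; Upper)

infix 4 _<ℝ_ _≤ℝ_ _≈ℝ_

_<ℝ_ : ℝ → ℝ → Set
x <ℝ y = ∃[ q ] (Upper x q × Lower y q)

_≤ℝ_ : ℝ → ℝ → Set
x ≤ℝ y = ∀ q → Lower x q → Lower y q

-- Locatedness makes the upper cut determined by the lower one, so comparing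
-- lower cuts suffices.
_≈ℝ_ : ℝ → ℝ → Set
x ≈ℝ y = x ≤ℝ y × y ≤ℝ x

fromℚ : ℚ → ℝ
fromℚ p = record
  { Lower           = ℚ._< p
  ; Upper           = p ℚ.<_
  ; lower-inhabited = p ℚ.- 1ℚ
                    , subst (p ℚ.- 1ℚ ℚ.<_) (ℚₚ.+-identityʳ p)
                        (ℚₚ.+-monoʳ-< p (ℚₚ.negative⁻¹ (ℚ.- 1ℚ)))
  ; upper-inhabited = p ℚ.+ 1ℚ
                    , subst (ℚ._< p ℚ.+ 1ℚ) (ℚₚ.+-identityʳ p)
                        (ℚₚ.+-monoʳ-< p (ℚₚ.positive⁻¹ 1ℚ))
  ; lower-rounded   = λ q → mk⇔ ℚₚ.<-dense (λ (_ , q<r , r<p) → ℚₚ.<-trans q<r r<p)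
  ; upper-rounded   = λ q → mk⇔ (λ p<q → let r , p<r , r<q = ℚₚ.<-dense p<q in r , r<q , p<r)
                                (λ (_ , r<q , p<r) → ℚₚ.<-trans p<r r<q)
  ; disjoint        = λ _ (q<p , p<q) → ℚₚ.<-asym q<p p<q
  ; located         = fromℚ-located
  }
  where
  fromℚ-located : ∀ q r → q ℚ.< r → (q ℚ.< p) ⊎ (p ℚ.< r)
  fromℚ-located q r q<r with ℚₚ.<-cmp q p
  ... | tri< q<p _ _ = inj₁ q<p
  ... | tri≈ _ q≡p _ = inj₂ (subst (ℚ._< r) q≡p q<r)
  ... | tri> _ _ p<q = inj₂ (ℚₚ.<-trans p<q q<r)

0ℝ 1ℝ : ℝ
0ℝ = fromℚ 0ℚ
1ℝ = fromℚ 1ℚ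

ℝ² : Set₁
ℝ² = ℝ × ℝ

infix 4 _≈ℝ²_

_≈ℝ²_ : ℝ² → ℝ² → Set
(x , y) ≈ℝ² (x′ , y′) = x ≈ℝ x′ × y ≈ℝ y′

xCoord yCoord : ℝ² → ℝ
xCoord = proj₁
yCoord = proj₂

UnitInterval : Set₁
UnitInterval = Σ[ t ∈ ℝ ] (0ℝ ≤ℝ t × t ≤ℝ 1ℝ)

0ᴵ 1ᴵ : UnitInterval
0ᴵ = 0ℝ , (λ _ q<0 → q<0) , (λ _ q<0 → ℚₚ.<-trans q<0 (ℚₚ.positive⁻¹ 1ℚ))
1ᴵ = 1ℝ , (λ _ q<0 → ℚₚ.<-trans q<0 (ℚₚ.positive⁻¹ 1ℚ)) , (λ _ q<1 → q<1)

infix 4 _<ᴵ_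

_<ᴵ_ : UnitInterval → UnitInterval → Set
s <ᴵ t = proj₁ s <ℝ proj₁ t

InOpen : ℚ → ℚ → ℝ → Set
InOpen p q x = Lower x p × Upper x q

-- Topological continuity, tested on the basis of open intervals with rational
-- endpoints. In particular a continuous function respects _≈ℝ_.
Continuous : (UnitInterval → ℝ) → Set₁
Continuous f = ∀ (t : UnitInterval) p q → InOpen p q (f t) →
  ∃[ r ] ∃[ s ] (InOpen r s (proj₁ t) ×
    (∀ (u : UnitInterval) → InOpen r s (proj₁ u) → InOpen p q (f u)))

record IsUpwardCurve (γ : UnitInterval → ℝ²) (start end : ℝ²) : Set₁ where
  field
    x-continuous : Continuous (λ t → xCoord (γ t))
    y-continuous : Continuous (λ t → yCoord (γ t))
    starts       : γ 0ᴵ ≈ℝ² start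
    ends         : γ 1ᴵ ≈ℝ² end
    y-increasing : ∀ s t → s <ᴵ t → yCoord (γ s) <ℝ yCoord (γ t)

record FinitePoset : Set₁ where
  infix 4 _≤_
  field
    Carrier        : Set
    _≤_            : Rel Carrier 0ℓ
    isPartialOrder : IsPartialOrder _≡_ _≤_
    size           : ℕ
    enumeration    : Carrier ↔ Fin size

IsLeast : ∀ {ℓ} → Pred ℕ ℓ → Pred ℕ ℓ
IsLeast S n = S n × (∀ m → S m → n ℕ.≤ m)

IsGreatest : ∀ {ℓ} → Pred ℕ ℓ → Pred ℕ ℓ
IsGreatest S n = S n × (∀ m → S m → m ℕ.≤ n)

module _ (P : FinitePoset) where
  open FinitePoset P

  HasChainOfSize : Pred ℕ 0ℓ
  HasChainOfSize k = Σ[ c ∈ (Fin k → Carrier) ]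
    (Injective _≡_ _≡_ c × (∀ i j → c i ≤ c j ⊎ c j ≤ c i))

  HasHeight : Pred ℕ 0ℓ
  HasHeight = IsGreatest HasChainOfSize

  IsIntersectionOfLinearOrders : Pred ℕ (lsuc 0ℓ)
  IsIntersectionOfLinearOrders d = Σ[ L ∈ (Fin d → Rel Carrier 0ℓ) ]
    ((∀ i → IsTotalOrder _≡_ (L i)) × (∀ x y → x ≤ y ⇔ (∀ i → L i x y)))

  HasDimension : Pred ℕ (lsuc 0ℓ)
  HasDimension = IsLeast IsIntersectionOfLinearOrders

  infix 4 _⋖_

  _⋖_ : Rel Carrier 0ℓ
  a ⋖ b = a ≤ b × a ≢ b × ¬ (∃[ c ] (c ≢ a × c ≢ b × a ≤ c × c ≤ b))

  -- curve a b is only meaningful when a ⋖ b; indexing by the pair rather than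
  -- by a proof of a ⋖ b gives each cover relation exactly one curve.
  record Diagram : Set₁ where
    field
      point          : Carrier → ℝ²
      point-distinct : Injective _≡_ _≈ℝ²_ point
      curve          : Carrier → Carrier → UnitInterval → ℝ²
      curve-upward   : ∀ a b → a ⋖ b → IsUpwardCurve (curve a b) (point a) (point b)

  record WithoutCrossings (D : Diagram) : Set₁ where
    open Diagram D
    field
      meet-at-common-endpoint :
        ∀ a b c d → a ⋖ b → c ⋖ d → (a , b) ≢ (c , d) →
        ∀ s t → curve a b s ≈ℝ² curve c d t →
        ∃[ e ] ((e ≡ a ⊎ e ≡ b) × (e ≡ c ⊎ e ≡ d) × curve a b s ≈ℝ² point e)
      avoid-other-points :
        ∀ a b → a ⋖ b → ∀ e s → curve a b s ≈ℝ² point e → e ≡ a ⊎ e ≡ b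

  Planar : Set₁
  Planar = ∃ WithoutCrossings

{-# OPTIONS --safe #-}

-- The poset is built from the inside out.  It always contains an element c at the bottom
-- and an element d at the top of its drawing, and pairs (aᵢ , bᵢ) with aᵢ ≤ d and c ≤ bᵢ
-- that form a standard example (aᵢ ≤ bⱼ exactly for i ≢ j); n such pairs force dimension
-- at least n.  Surrounding the drawing by a frame creates a new bottom c′ ≤ c and a new
-- top d ≤ d′, and new pairs with a ≤ c, a ≤ d′, c′ ≤ b, d ≤ b, so that old and new
-- pairs again form a standard example.  Kelly's frame adds one pair and one unit of
-- height.  The double frame adds four pairs for three units of height: on one side it
-- replaces a point of the c-chain by two incomparable points z, w, which cover both
-- comparabilities a₁ ≤ b₂ and a₂ ≤ b₁ and leave only a single new point on the d-chain;
-- then the roles of the two chains are exchanged.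
--
-- All covers are drawn as straight segments between integer points.  Each frame is drawn
-- once around the square [-1,1]² and stretched to fit around the box of the inner drawing,
-- so planarity is a finite computation per frame: a crossing is excluded by a line
-- separating the two segments, or the segment and the box.

module Submission where

open import Defs

-- Because `c` is never below `d`, no chain runs from below `c` through the inner poset to above
-- `d`. The height therefore grows by the larger of the amounts that a frame adds to the two chains,
-- not by their sum. This is why unequal layers pay off once they are balanced against each other:
-- two points on one chain and one on the other, then the reverse, make three on each for four
-- pairs. The small cases have 0, 1, 2 pairs at heights 1, 2, 3 and miss 4/3 of the height by 4/3,
-- 5/3 and 2; the worst of these is the additive constant. Two obstacles are constructive. Points of
-- curves have Dedekind coordinates, whose order cannot be decided, so a crossing has to be refuted
-- through rational brackets of the two parameters. And the dimension is demanded as an actual least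
-- number, which calls for a decision procedure for being an intersection of a given number of
-- linear orders.

-- Affine functions of a Dedekind real parameter

module Reals where
  open import Data.Empty using (⊥-elim)
  open import Data.Integer.Base as ℤ using (ℤ; +_; -[1+_])
  import Data.Integer.Properties as ℤₚ
  open import Data.Nat.Base as ℕ using (ℕ; zero; suc)
  open import Data.Product using (∃-syntax; _×_; _,_; proj₁; proj₂)
  open import Data.Rational.Base
  open import Data.Rational.Properties
  import Data.Rational.Unnormalised.Base as ℚᵘ
  import Data.Rational.Unnormalised.Properties as ℚᵘₚ
  open import Data.Sum.Base using (_⊎_; inj₁; inj₂)
  open import Function.Bundles using (mk⇔; Equivalence)
  open import Level using (0ℓ)
  open import Relation.Binary.Definitions using (tri<; tri≈; tri>)
  open import Relation.Binary.PropositionalEquality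
  open import Relation.Nullary.Decidable using (yes; no; dec⇒maybe)
  open import Relation.Nullary.Negation using (¬_; contradiction)
  open import Tactic.RingSolver using (solve-∀)
  open import Tactic.RingSolver.Core.AlmostCommutativeRing using (AlmostCommutativeRing; fromCommutativeRing)

  ℚ-ring : AlmostCommutativeRing 0ℓ 0ℓ
  ℚ-ring = fromCommutativeRing +-*-commutativeRing (λ x → dec⇒maybe (0ℚ ≟ x))

  p+q-p≡q : ∀ p q → p + (q - p) ≡ q
  p+q-p≡q = solve-∀ ℚ-ring

  0≤q-p⇒p≤q : ∀ p q → 0ℚ ≤ q - p → p ≤ q
  0≤q-p⇒p≤q p q 0≤ = subst₂ _≤_ (+-identityʳ p) (p+q-p≡q p q) (+-monoʳ-≤ p 0≤)

  p≤q⇒0≤q-p : ∀ {p q} → p ≤ q → 0ℚ ≤ q - p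
  p≤q⇒0≤q-p {p} {q} p≤q = subst (_≤ q - p) (+-inverseʳ p) (+-monoˡ-≤ (- p) p≤q)

  p<q⇒0<q-p : ∀ {p q} → p < q → 0ℚ < q - p
  p<q⇒0<q-p {p} {q} p<q = subst (_< q - p) (+-inverseʳ p) (+-monoˡ-< (- p) p<q)

  p<p+ε : ∀ p {ε} → 0ℚ < ε → p < p + ε
  p<p+ε p {ε} 0<ε = subst (_< p + ε) (+-identityʳ p) (+-monoʳ-< p 0<ε)

  *-pos : ∀ {p q} → 0ℚ < p → 0ℚ < q → 0ℚ < p * q
  *-pos {p} {q} 0<p 0<q = positive⁻¹ (p * q) ⦃ pos*pos⇒pos p ⦃ positive 0<p ⦄ q ⦃ positive 0<q ⦄ ⦄

  *-nonNeg : ∀ {p q} → 0ℚ ≤ p → 0ℚ ≤ q → 0ℚ ≤ p * q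
  *-nonNeg {p} {q} 0≤p 0≤q =
    nonNegative⁻¹ (p * q) ⦃ nonNeg*nonNeg⇒nonNeg p ⦃ nonNegative 0≤p ⦄ q ⦃ nonNegative 0≤q ⦄ ⦄

  p≤∣p∣ : ∀ p → p ≤ ∣ p ∣
  p≤∣p∣ p with ≤-total 0ℚ p
  ... | inj₁ 0≤p = ≤-reflexive (sym (0≤p⇒∣p∣≡p 0≤p))
  ... | inj₂ p≤0 = ≤-trans p≤0 (0≤∣p∣ p)

  pq≤∣p∣∣q∣ : ∀ p q → p * q ≤ ∣ p ∣ * ∣ q ∣
  pq≤∣p∣∣q∣ p q = subst (p * q ≤_) (∣p*q∣≡∣p∣*∣q∣ p q) (p≤∣p∣ (p * q))

  ∣p∣≤ : ∀ {p q} → p ≤ q → - p ≤ q → ∣ p ∣ ≤ q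
  ∣p∣≤ {p} {q} p≤q -p≤q with ∣p∣≡p∨∣p∣≡-p p
  ... | inj₁ eq = subst (_≤ q) (sym eq) p≤q
  ... | inj₂ eq = subst (_≤ q) (sym eq) -p≤q

  ∃-small : ∀ c {δ} → 0ℚ < δ → ∃[ ε ] (0ℚ < ε × c * ε < δ)
  ∃-small c {δ} 0<δ = ε , 0<ε , ≤-<-trans c*ε≤ (subst (∣ c ∣ * ε <_) total (p<p+ε _ 0<ε))
    where
    -- The summand 1 keeps the divisor positive when `c` is zero and makes the bound strict, as
    -- `∣ c ∣ * ε + ε` is exactly `δ`.
    m = ∣ c ∣ + 1ℚ
    0<m : 0ℚ < m
    0<m = ≤-<-trans (0≤∣p∣ c) (p<p+ε ∣ c ∣ (positive⁻¹ 1ℚ))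
    instance
      m-pos : Positive m
      m-pos = positive 0<m
      m-nonZero : NonZero m
      m-nonZero = pos⇒nonZero m
    ε = δ * (1/ m)
    0<ε : 0ℚ < ε
    0<ε = *-pos 0<δ (positive⁻¹ (1/ m) ⦃ 1/pos⇒pos m ⦄)
    rearrange : ∀ a d i → a * (d * i) + d * i ≡ d * ((a + 1ℚ) * i)
    rearrange = solve-∀ ℚ-ring
    total : ∣ c ∣ * ε + ε ≡ δ
    total = trans (rearrange ∣ c ∣ δ (1/ m)) (trans (cong (δ *_) (*-inverseʳ m)) (*-identityʳ δ))
    c*ε≤ : c * ε ≤ ∣ c ∣ * ε
    c*ε≤ = *-monoʳ-≤-nonNeg ε ⦃ nonNegative (<⇒≤ 0<ε) ⦄ (p≤∣p∣ c)

  opaque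
    -- Opaque, so that integers enter the arguments about reals only through the ring and order laws
    -- below, never through a normalised fraction.
    ι : ℤ → ℚ
    ι z = z / 1

    ι-≃ : ∀ z → toℚᵘ (ι z) ℚᵘ.≃ ℚᵘ.mkℚᵘ z 0
    ι-≃ z = toℚᵘ-fromℚᵘ (ℚᵘ.mkℚᵘ z 0)

    ι-0 : ι ℤ.0ℤ ≡ 0ℚ
    ι-0 = refl

    ι-1 : ι ℤ.1ℤ ≡ 1ℚ
    ι-1 = refl

    ι-homo-+ : ∀ a b → ι (a ℤ.+ b) ≡ ι a + ι b
    ι-homo-+ a b = toℚᵘ-injective (begin
      toℚᵘ (ι (a ℤ.+ b))                     ≈⟨ ι-≃ (a ℤ.+ b) ⟩
      ℚᵘ.mkℚᵘ (a ℤ.+ b) 0                    ≈⟨ ℚᵘ.*≡* (cong (ℤ._* + 1) (cong₂ ℤ._+_ (sym (ℤₚ.*-identityʳ a)) (sym (ℤₚ.*-identityʳ b)))) ⟩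
      ℚᵘ.mkℚᵘ a 0 ℚᵘ.+ ℚᵘ.mkℚᵘ b 0           ≈⟨ ℚᵘₚ.+-cong (ι-≃ a) (ι-≃ b) ⟨
      toℚᵘ (ι a) ℚᵘ.+ toℚᵘ (ι b)             ≈⟨ toℚᵘ-homo-+ (ι a) (ι b) ⟨
      toℚᵘ (ι a + ι b)                       ∎)
      where open ℚᵘₚ.≃-Reasoning

    ι-homo-* : ∀ a b → ι (a ℤ.* b) ≡ ι a * ι b
    ι-homo-* a b = toℚᵘ-injective (begin
      toℚᵘ (ι (a ℤ.* b))                     ≈⟨ ι-≃ (a ℤ.* b) ⟩
      ℚᵘ.mkℚᵘ a 0 ℚᵘ.* ℚᵘ.mkℚᵘ b 0           ≈⟨ ℚᵘₚ.*-cong (ι-≃ a) (ι-≃ b) ⟨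
      toℚᵘ (ι a) ℚᵘ.* toℚᵘ (ι b)             ≈⟨ toℚᵘ-homo-* (ι a) (ι b) ⟨
      toℚᵘ (ι a * ι b)                       ∎)
      where open ℚᵘₚ.≃-Reasoning

    ι-mono-≤ : ∀ {a b} → a ℤ.≤ b → ι a ≤ ι b
    ι-mono-≤ {a} {b} a≤b = toℚᵘ-cancel-≤ (begin
      toℚᵘ (ι a)    ≃⟨ ι-≃ a ⟩
      ℚᵘ.mkℚᵘ a 0   ≤⟨ ℚᵘ.*≤* (ℤₚ.*-monoʳ-≤-nonNeg (+ 1) a≤b) ⟩
      ℚᵘ.mkℚᵘ b 0   ≃⟨ ι-≃ b ⟨
      toℚᵘ (ι b)    ∎)
      where open ℚᵘₚ.≤-Reasoning

    ι-mono-< : ∀ {a b} → a ℤ.< b → ι a < ι b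
    ι-mono-< {a} {b} a<b = toℚᵘ-cancel-< (begin-strict
      toℚᵘ (ι a)    ≃⟨ ι-≃ a ⟩
      ℚᵘ.mkℚᵘ a 0   <⟨ ℚᵘ.*<* (ℤₚ.*-monoʳ-<-pos (+ 1) a<b) ⟩
      ℚᵘ.mkℚᵘ b 0   ≃⟨ ι-≃ b ⟨
      toℚᵘ (ι b)    ∎)
      where open ℚᵘₚ.≤-Reasoning

    ι-injective : ∀ {a b} → ι a ≡ ι b → a ≡ b
    ι-injective {a} {b} eq with ℤₚ.<-cmp a b
    ... | tri< a<b _ _ = contradiction eq (<⇒≢ (ι-mono-< a<b))
    ... | tri≈ _ a≡b _ = a≡b
    ... | tri> _ _ b<a = contradiction (sym eq) (<⇒≢ (ι-mono-< b<a))

    -- The denominator is at least 1, so dividing by it cannot increase the absolute value of the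
    -- numerator.
    ≤ι∣↥∣ : ∀ p → p ≤ ι (+ ℤ.∣ ↥ p ∣)
    ≤ι∣↥∣ p@record{} = toℚᵘ-cancel-≤ (begin
      toℚᵘ p                        ≤⟨ ℚᵘ.*≤* numerator ⟩
      ℚᵘ.mkℚᵘ (+ ℤ.∣ ↥ p ∣) 0       ≃⟨ ι-≃ (+ ℤ.∣ ↥ p ∣) ⟨
      toℚᵘ (ι (+ ℤ.∣ ↥ p ∣))        ∎)
      where
      open ℚᵘₚ.≤-Reasoning
      i≤∣i∣ : ∀ i → i ℤ.≤ + ℤ.∣ i ∣
      i≤∣i∣ (+ n)    = ℤₚ.≤-refl
      i≤∣i∣ -[1+ n ] = ℤ.-≤+
      numerator : ↥ p ℤ.* + 1 ℤ.≤ + ℤ.∣ ↥ p ∣ ℤ.* ↧ p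
      numerator = subst (ℤ._≤ + ℤ.∣ ↥ p ∣ ℤ.* ↧ p) (sym (ℤₚ.*-identityʳ (↥ p)))
        (ℤₚ.≤-trans (i≤∣i∣ (↥ p))
          (subst (ℤ._≤ + ℤ.∣ ↥ p ∣ ℤ.* ↧ p) (ℤₚ.*-identityʳ _)
            (ℤₚ.*-monoˡ-≤-nonNeg (+ ℤ.∣ ↥ p ∣) (ℤ.+≤+ (ℕ.s≤s ℕ.z≤n)))))

  archimedean : ∀ p {η} → 0ℚ < η → ∃[ n ] p ≤ ι (+ n) * η
  archimedean p {η} 0<η = n , subst (_≤ ι (+ n) * η) cancel (*-monoʳ-≤-nonNeg η ⦃ pos⇒nonNeg η ⦃ positive 0<η ⦄ ⦄ (≤ι∣↥∣ (p * (1/ η))))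
    where
    instance
      η-nonZero : NonZero η
      η-nonZero = pos⇒nonZero η ⦃ positive 0<η ⦄
    n = ℤ.∣ ↥ (p * (1/ η)) ∣
    cancel : p * (1/ η) * η ≡ p
    cancel = trans (*-assoc p (1/ η) η) (trans (cong (p *_) (*-inverseˡ η)) (*-identityʳ p))

  Lower-closed : ∀ x {p q} → p < q → Lower x q → Lower x p
  Lower-closed x {p} {q} p<q l = Equivalence.from (ℝ.lower-rounded x p) (q , p<q , l)

  Upper-closed : ∀ x {p q} → p < q → Upper x p → Upper x q
  Upper-closed x {p} {q} p<q u = Equivalence.from (ℝ.upper-rounded x q) (p , p<q , u)

  Upper-closed-≤ : ∀ x {p q} → p ≤ q → Upper x p → Upper x q
  Upper-closed-≤ x {p} {q} p≤q u =
    let r , r<p , u′ = Equivalence.to (ℝ.upper-rounded x p) u in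
    Upper-closed x (<-≤-trans r<p p≤q) u′

  Lower-closed-≤ : ∀ x {p q} → p ≤ q → Lower x q → Lower x p
  Lower-closed-≤ x {p} {q} p≤q l =
    let r , q<r , l′ = Equivalence.to (ℝ.lower-rounded x q) l in
    Lower-closed x (≤-<-trans p≤q q<r) l′

  Lower<Upper : ∀ x {p q} → Lower x p → Upper x q → p < q
  Lower<Upper x {p} {q} l u =
    ≰⇒> λ q≤p → ℝ.disjoint x p (l , Upper-closed-≤ x q≤p u)

  -- Walking up from `l` in steps of `η < ε`, locatedness between `l + η` and `l + ε` either allows
  -- another step or closes the bracket. The Archimedean property bounds the number of steps.
  -- Keeping `l ≤ r` lets the result refine a bracket that is already known.
  approximate : ∀ x {l ε} → Lower x l → 0ℚ < ε → ∃[ r ] (l ≤ r × Lower x r × Upper x (r + ε))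
  approximate x {l} {ε} Ll 0<ε =
    let η , 0<η , η<ε = <-dense 0<ε
        u , Uu        = ℝ.upper-inhabited x
        n , u-l≤nη    = archimedean (u - l) 0<η
        u≤l+nη        = subst (_≤ l + ι (+ n) * η) (p+q-p≡q l u) (+-monoʳ-≤ l u-l≤nη)
    in walk 0<η η<ε n l Ll (Upper-closed-≤ x u≤l+nη Uu)
    where
    walk : ∀ {η} → 0ℚ < η → η < ε → ∀ n l → Lower x l → Upper x (l + ι (+ n) * η) →
           ∃[ r ] (l ≤ r × Lower x r × Upper x (r + ε))
    walk {η} 0<η η<ε zero    l Ll U = l , ≤-refl , Ll ,
      Upper-closed-≤ x (+-monoʳ-≤ l (≤-trans (≤-reflexive (trans (cong (_* η) ι-0) (*-zeroˡ η))) (<⇒≤ 0<ε))) U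
    walk {η} 0<η η<ε (suc n) l Ll U with ℝ.located x (l + η) (l + ε) (+-monoʳ-< l η<ε)
    ... | inj₂ U′ = l , ≤-refl , Ll , U′
    ... | inj₁ L′ =
      let r , l+η≤r , Lr , Ur = walk 0<η η<ε n (l + η) L′ (subst (Upper x) step U)
      in r , ≤-trans (<⇒≤ (p<p+ε l 0<η)) l+η≤r , Lr , Ur
      where
      regroup : ∀ l m η → l + (1ℚ + m) * η ≡ l + η + m * η
      regroup = solve-∀ ℚ-ring
      step : l + ι (+ suc n) * η ≡ l + η + ι (+ n) * η
      step = trans (cong (λ k → l + k * η) (trans (ι-homo-+ (+ 1) (+ n)) (cong (_+ ι (+ n)) ι-1))) (regroup l (ι (+ n)) η)

  -- On an interval an affine function is smallest at an endpoint; the sign of `v` tells which one.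
  affine-convex-> : ∀ u v {q r₁ r r₂} → r₁ ≤ r → r ≤ r₂ → q < u + v * r₁ → q < u + v * r₂ → q < u + v * r
  affine-convex-> u v r₁≤r r≤r₂ q<₁ q<₂ with ≤-total 0ℚ v
  ... | inj₁ 0≤v = <-≤-trans q<₁ (+-monoʳ-≤ u (*-monoˡ-≤-nonNeg v ⦃ nonNegative 0≤v ⦄ r₁≤r))
  ... | inj₂ v≤0 = <-≤-trans q<₂ (+-monoʳ-≤ u (*-monoˡ-≤-nonPos v ⦃ nonPositive v≤0 ⦄ r≤r₂))

  affine-convex-< : ∀ u v {q r₁ r r₂} → r₁ ≤ r → r ≤ r₂ → u + v * r₁ < q → u + v * r₂ < q → u + v * r < q
  affine-convex-< u v r₁≤r r≤r₂ <q₁ <q₂ with ≤-total 0ℚ v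
  ... | inj₁ 0≤v = ≤-<-trans (+-monoʳ-≤ u (*-monoˡ-≤-nonNeg v ⦃ nonNegative 0≤v ⦄ r≤r₂)) <q₂
  ... | inj₂ v≤0 = ≤-<-trans (+-monoʳ-≤ u (*-monoˡ-≤-nonPos v ⦃ nonPositive v≤0 ⦄ r₁≤r)) <q₁

  ⊔-< : ∀ {p q r} → p < r → q < r → p ⊔ q < r
  ⊔-< {p} {q} {r} p<r q<r with ⊔-sel p q
  ... | inj₁ eq = subst (_< r) (sym eq) p<r
  ... | inj₂ eq = subst (_< r) (sym eq) q<r

  ⊓-> : ∀ {p q r} → r < p → r < q → r < p ⊓ q
  ⊓-> {p} {q} {r} r<p r<q with ⊓-sel p q
  ... | inj₁ eq = subst (r <_) (sym eq) r<p
  ... | inj₂ eq = subst (r <_) (sym eq) r<q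

  Lower-⊔ : ∀ x {p q} → Lower x p → Lower x q → Lower x (p ⊔ q)
  Lower-⊔ x {p} {q} lp lq with ⊔-sel p q
  ... | inj₁ eq = subst (Lower x) (sym eq) lp
  ... | inj₂ eq = subst (Lower x) (sym eq) lq

  Upper-⊓ : ∀ x {p q} → Upper x p → Upper x q → Upper x (p ⊓ q)
  Upper-⊓ x {p} {q} up uq with ⊓-sel p q
  ... | inj₁ eq = subst (Upper x) (sym eq) up
  ... | inj₂ eq = subst (Upper x) (sym eq) uq

  -- Quantifying over a bracket r₁ < t < r₂ covers both signs of v at once.
  affine : ℚ → ℚ → ℝ → ℝ
  affine u v t = record
    { Lower           = Below
    ; Upper           = Above
    ; lower-inhabited =
        let a = u + v * l ; b = u + v * h ; q , q< = below (a ⊓ b)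
        in q , l , h , Ll , Uh , <-≤-trans q< (p⊓q≤p a b) , <-≤-trans q< (p⊓q≤q a b)
    ; upper-inhabited =
        let a = u + v * l ; b = u + v * h ; q , <q = above (a ⊔ b)
        in q , l , h , Ll , Uh , ≤-<-trans (p≤p⊔q a b) <q , ≤-<-trans (p≤q⊔p a b) <q
    ; lower-rounded   = λ q → mk⇔
        (λ (r₁ , r₂ , L₁ , U₂ , q<₁ , q<₂) →
          let s , q<s , s< = <-dense (⊓-> q<₁ q<₂)
          in s , q<s , r₁ , r₂ , L₁ , U₂ , <-≤-trans s< (p⊓q≤p (u + v * r₁) _) , <-≤-trans s< (p⊓q≤q (u + v * r₁) _))
        (λ (s , q<s , r₁ , r₂ , L₁ , U₂ , s<₁ , s<₂) →
          r₁ , r₂ , L₁ , U₂ , <-trans q<s s<₁ , <-trans q<s s<₂)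
    ; upper-rounded   = λ q → mk⇔
        (λ (r₁ , r₂ , L₁ , U₂ , <q₁ , <q₂) →
          let s , <s , s<q = <-dense (⊔-< <q₁ <q₂)
          in s , s<q , r₁ , r₂ , L₁ , U₂ , ≤-<-trans (p≤p⊔q (u + v * r₁) _) <s , ≤-<-trans (p≤q⊔p (u + v * r₁) _) <s)
        (λ (s , s<q , r₁ , r₂ , L₁ , U₂ , <s₁ , <s₂) →
          r₁ , r₂ , L₁ , U₂ , <-trans <s₁ s<q , <-trans <s₂ s<q)
    -- `m` lies in both brackets, so convexity compares `q` with the single value at `m` in both
    -- directions.
    ; disjoint        = λ q ((r₁ , r₂ , L₁ , U₂ , q<₁ , q<₂) , (s₁ , s₂ , L₁′ , U₂′ , <q₁ , <q₂)) →
        let m    = r₁ ⊔ s₁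
            Lm   = Lower-⊔ t L₁ L₁′
            m≤r₂ = <⇒≤ (Lower<Upper t Lm U₂)
            m≤s₂ = <⇒≤ (Lower<Upper t Lm U₂′)
        in <-asym (affine-convex-> u v (p≤p⊔q r₁ s₁) m≤r₂ q<₁ q<₂)
                  (affine-convex-< u v (p≤q⊔p r₁ s₁) m≤s₂ <q₁ <q₂)
    ; located         = locate
    }
    where
    Below Above : ℚ → Set
    Below q = ∃[ r₁ ] ∃[ r₂ ] (Lower t r₁ × Upper t r₂ × q < u + v * r₁ × q < u + v * r₂)
    Above q = ∃[ r₁ ] ∃[ r₂ ] (Lower t r₁ × Upper t r₂ × u + v * r₁ < q × u + v * r₂ < q)

    l h : ℚ
    l = proj₁ (ℝ.lower-inhabited t)
    h = proj₁ (ℝ.upper-inhabited t)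
    Ll : Lower t l
    Ll = proj₂ (ℝ.lower-inhabited t)
    Uh : Upper t h
    Uh = proj₂ (ℝ.upper-inhabited t)

    below : ∀ p → ∃[ q ] q < p
    below p = ℝ.lower-inhabited (fromℚ p)
    above : ∀ p → ∃[ q ] p < q
    above p = ℝ.upper-inhabited (fromℚ p)

    expand : ∀ u v r ε → u + v * (r + ε) ≡ u + v * r + v * ε
    expand = solve-∀ ℚ-ring
    contract : ∀ u v r ε → u + v * r ≡ u + v * (r + ε) + (- v) * ε
    contract = solve-∀ ℚ-ring

    -- Over a bracket of width `ε` the value changes by at most `∣ v ∣ * ε`, which is less than
    -- `q′ - q`. Hence either both ends have values above `q`, or one value is at most `q` and then
    -- both are below `q′`; this is a decidable comparison of rationals.
    locate : ∀ q q′ → q < q′ → Below q ⊎ Above q′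
    locate q q′ q<q′ =
      let ε , 0<ε , small   = ∃-small ∣ v ∣ (p<q⇒0<q-p q<q′)
          r , _ , Lr , Ur   = approximate t Ll 0<ε
      in decide ε 0<ε small r Lr Ur
      where
      decide : ∀ ε → 0ℚ < ε → ∣ v ∣ * ε < q′ - q → ∀ r → Lower t r → Upper t (r + ε) → Below q ⊎ Above q′
      decide ε 0<ε small r Lr Ur with q <? u + v * r | q <? u + v * (r + ε)
      ... | yes q<₁ | yes q<₂ = inj₁ (r , r + ε , Lr , Ur , q<₁ , q<₂)
      ... | no q≮₁ | _ = inj₂ (r , r + ε , Lr , Ur , ≤-<-trans (≮⇒≥ q≮₁) q<q′ , second)
        where
        second : u + v * (r + ε) < q′
        second = begin-strict
          u + v * (r + ε)        ≡⟨ expand u v r ε ⟩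
          u + v * r + v * ε      ≤⟨ +-mono-≤ (≮⇒≥ q≮₁) (*-monoʳ-≤-nonNeg ε ⦃ nonNegative (<⇒≤ 0<ε) ⦄ (p≤∣p∣ v)) ⟩
          q + ∣ v ∣ * ε          <⟨ +-monoʳ-< q small ⟩
          q + (q′ - q)           ≡⟨ p+q-p≡q q q′ ⟩
          q′                     ∎
          where open ≤-Reasoning
      ... | yes _ | no q≮₂ = inj₂ (r , r + ε , Lr , Ur , first , ≤-<-trans (≮⇒≥ q≮₂) q<q′)
        where
        first : u + v * r < q′
        first = begin-strict
          u + v * r                      ≡⟨ contract u v r ε ⟩
          u + v * (r + ε) + (- v) * ε    ≤⟨ +-mono-≤ (≮⇒≥ q≮₂) (*-monoʳ-≤-nonNeg ε ⦃ nonNegative (<⇒≤ 0<ε) ⦄ (subst (- v ≤_) (∣-p∣≡∣p∣ v) (p≤∣p∣ (- v)))) ⟩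
          q + ∣ v ∣ * ε                  <⟨ +-monoʳ-< q small ⟩
          q + (q′ - q)                   ≡⟨ p+q-p≡q q q′ ⟩
          q′                             ∎
          where open ≤-Reasoning

  ≈ℝ-refl : ∀ x → x ≈ℝ x
  ≈ℝ-refl x = (λ _ l → l) , (λ _ l → l)

  -- Rounding `q` down to `r` leaves room to locate `x`: if `r` were below `x`, it would be below
  -- `y` as well, yet it is an upper bound of `y`.
  ≤ℝ⇒Upper : ∀ x y → x ≤ℝ y → ∀ {q} → Upper y q → Upper x q
  ≤ℝ⇒Upper x y x≤y {q} Uy with Equivalence.to (ℝ.upper-rounded y q) Uy
  ... | r , r<q , Ur with ℝ.located x r q r<q
  ... | inj₂ Ux = Ux
  ... | inj₁ Lx = contradiction (x≤y r Lx , Ur) (ℝ.disjoint y r)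

  affine-at : ∀ u v r t → t ≈ℝ fromℚ r → affine u v t ≈ℝ fromℚ (u + v * r)
  affine-at u v r t (t≤r , r≤t) = below , above
    where
    below : affine u v t ≤ℝ fromℚ (u + v * r)
    below q (r₁ , r₂ , L₁ , U₂ , q<₁ , q<₂) =
      affine-convex-> u v (<⇒≤ (t≤r r₁ L₁)) (<⇒≤ (≤ℝ⇒Upper (fromℚ r) t r≤t U₂)) q<₁ q<₂
    shiftᵘ : ∀ u v r ε → u + v * r ≡ u + v * (r + ε) + (- v) * ε
    shiftᵘ = solve-∀ ℚ-ring
    shiftˡ : ∀ u v r ε → u + v * r ≡ u + v * (r - ε) + v * ε
    shiftˡ = solve-∀ ℚ-ring
    -- Moving from `r` to `r - ε` or `r + ε` costs at most `∣ v ∣ * ε`, which is less than the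
    -- distance from `q` to the value at `r`; so these two points form a bracket that witnesses `q`.
    above : fromℚ (u + v * r) ≤ℝ affine u v t
    above q q< = r - ε , r + ε , r≤t _ r-ε<r , ≤ℝ⇒Upper t (fromℚ r) t≤r (p<p+ε r 0<ε)
               , cancel (shiftˡ u v r ε) (p≤∣p∣ v)
               , cancel (shiftᵘ u v r ε) (subst (- v ≤_) (∣-p∣≡∣p∣ v) (p≤∣p∣ (- v)))
      where
      slack = ∃-small ∣ v ∣ (p<q⇒0<q-p q<)
      ε = proj₁ slack
      0<ε = proj₁ (proj₂ slack)
      r-ε<r : r - ε < r
      r-ε<r = subst (r - ε <_) (+-identityʳ r) (+-monoʳ-< r (neg-antimono-< 0<ε))
      cancel : ∀ {a w} → u + v * r ≡ a + w * ε → w ≤ ∣ v ∣ → q < a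
      cancel {a} {w} eq w≤ = ≰⇒> λ a≤q → <-irrefl (sym (p+q-p≡q q (u + v * r))) (begin-strict
        u + v * r                   ≡⟨ eq ⟩
        a + w * ε                   ≤⟨ +-mono-≤ a≤q (*-monoʳ-≤-nonNeg ε ⦃ nonNegative (<⇒≤ 0<ε) ⦄ w≤) ⟩
        q + ∣ v ∣ * ε               <⟨ +-monoʳ-< q (proj₂ (proj₂ slack)) ⟩
        q + (u + v * r - q)         ∎)
        where open ≤-Reasoning

  -- Over its bracket each function stays within slope times `ε` of its value at the left end. If
  -- those values were further apart than the two variations together, a rational would fit between
  -- `hi` and `lo`, below the first real and above the second.
  affine-≤-gap : ∀ u v u′ v′ s t → affine u v s ≤ℝ affine u′ v′ t →
    ∀ {b b′ ε} → 0ℚ < ε → Lower s b → Upper s (b + ε) → Lower t b′ → Upper t (b′ + ε) →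
    (u + v * b) - (u′ + v′ * b′) ≤ (∣ v ∣ + ∣ v′ ∣) * ε
  affine-≤-gap u v u′ v′ s t A≤A′ {b} {b′} {ε} 0<ε Ls Us Lt Ut = ≮⇒≥ λ gap →
    let q , hi<q , q<lo = <-dense (0<q-p⇒p<q hi lo (subst (0ℚ <_) (regroup (u + v * b) (u′ + v′ * b′) (∣ v ∣) (∣ v′ ∣) ε) (p<q⇒0<q-p gap)))
    in ℝ.disjoint (affine u′ v′ t) q
         ( A≤A′ q (b , b + ε , Ls , Us , <-≤-trans q<lo lo₀ , <-≤-trans q<lo lo₁)
         , (b′ , b′ + ε , Lt , Ut , ≤-<-trans hi₀ hi<q , ≤-<-trans hi₁ hi<q))
    where
    0≤ε = <⇒≤ 0<ε
    lo hi : ℚ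
    lo = (u + v * b) - ∣ v ∣ * ε
    hi = (u′ + v′ * b′) + ∣ v′ ∣ * ε
    0<q-p⇒p<q : ∀ p q → 0ℚ < q - p → p < q
    0<q-p⇒p<q p q 0< = subst₂ _<_ (+-identityʳ p) (p+q-p≡q p q) (+-monoʳ-< p 0<)
    regroup : ∀ a a′ w w′ ε → (a - a′) - (w + w′) * ε ≡ (a - w * ε) - (a′ + w′ * ε)
    regroup = solve-∀ ℚ-ring
    lo-gap₀ : ∀ a w ε → a - (a - w * ε) ≡ w * ε
    lo-gap₀ = solve-∀ ℚ-ring
    lo-gap₁ : ∀ u v b w ε → (u + v * (b + ε)) - ((u + v * b) - w * ε) ≡ (w - (- v)) * ε
    lo-gap₁ = solve-∀ ℚ-ring
    hi-gap₀ : ∀ a w ε → (a + w * ε) - a ≡ w * ε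
    hi-gap₀ = solve-∀ ℚ-ring
    hi-gap₁ : ∀ u v b w ε → ((u + v * b) + w * ε) - (u + v * (b + ε)) ≡ (w - v) * ε
    hi-gap₁ = solve-∀ ℚ-ring
    -v≤∣v∣ : - v ≤ ∣ v ∣
    -v≤∣v∣ = subst (- v ≤_) (∣-p∣≡∣p∣ v) (p≤∣p∣ (- v))
    lo₀ : lo ≤ u + v * b
    lo₀ = 0≤q-p⇒p≤q _ _ (subst (0ℚ ≤_) (sym (lo-gap₀ (u + v * b) (∣ v ∣) ε)) (*-nonNeg (0≤∣p∣ v) 0≤ε))
    lo₁ : lo ≤ u + v * (b + ε)
    lo₁ = 0≤q-p⇒p≤q _ _ (subst (0ℚ ≤_) (sym (lo-gap₁ u v b (∣ v ∣) ε)) (*-nonNeg (p≤q⇒0≤q-p -v≤∣v∣) 0≤ε))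
    hi₀ : u′ + v′ * b′ ≤ hi
    hi₀ = 0≤q-p⇒p≤q _ _ (subst (0ℚ ≤_) (sym (hi-gap₀ (u′ + v′ * b′) (∣ v′ ∣) ε)) (*-nonNeg (0≤∣p∣ v′) 0≤ε))
    hi₁ : u′ + v′ * (b′ + ε) ≤ hi
    hi₁ = 0≤q-p⇒p≤q _ _ (subst (0ℚ ≤_) (sym (hi-gap₁ u′ v′ b′ (∣ v′ ∣) ε)) (*-nonNeg (p≤q⇒0≤q-p (p≤∣p∣ v′)) 0≤ε))

  affine-≈-gap : ∀ u v u′ v′ s t → affine u v s ≈ℝ affine u′ v′ t →
    ∀ {b b′ ε} → 0ℚ < ε → Lower s b → Upper s (b + ε) → Lower t b′ → Upper t (b′ + ε) →
    ∣ (u + v * b) - (u′ + v′ * b′) ∣ ≤ (∣ v ∣ + ∣ v′ ∣) * ε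
  affine-≈-gap u v u′ v′ s t (A≤A′ , A′≤A) {b} {b′} {ε} 0<ε Ls Us Lt Ut = ∣p∣≤
    (affine-≤-gap u v u′ v′ s t A≤A′ 0<ε Ls Us Lt Ut)
    (subst₂ _≤_ (flip (u + v * b) (u′ + v′ * b′)) (cong (_* ε) (+-comm ∣ v′ ∣ ∣ v ∣))
      (affine-≤-gap u′ v′ u v t s A′≤A 0<ε Lt Ut Ls Us))
    where
    flip : ∀ a a′ → a′ - a ≡ - (a - a′)
    flip = solve-∀ ℚ-ring

  -- No sum of reals is formed. Both parameters are sampled at rationals within `ε`; the sampled
  -- coordinates then differ by at most a multiple of `ε`, hence so do the sampled combinations, and
  -- the fixed gap from `q′` to `q″` becomes impossible for small `ε`.
  affine-combine-≤ : ∀ κ α β {u v u′ v′ w z w′ z′} s t →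
    affine u v s ≈ℝ affine u′ v′ t → affine w z s ≈ℝ affine w′ z′ t →
    affine (κ + (α * u + β * w)) (α * v + β * z) s ≤ℝ affine (κ + (α * u′ + β * w′)) (α * v′ + β * z′) t
  affine-combine-≤ κ α β {u} {v} {u′} {v′} {w} {z} {w′} {z′} s t A≈ B≈ q Lq =
    let q″ , q<q″ , Lq″ = Equivalence.to (ℝ.lower-rounded G q) Lq
        q′ , q<q′ , q′<q″ = <-dense q<q″
    in decide q″ q′ q′<q″ Lq″ (ℝ.located G′ q q′ q<q′)
    where
    G  = affine (κ + (α * u + β * w)) (α * v + β * z) s
    G′ = affine (κ + (α * u′ + β * w′)) (α * v′ + β * z′) t
    -- The bound on the difference of the sampled combinations per unit of `ε`, with the two
    -- coordinates weighted by `α` and `β`.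
    c = ∣ α ∣ * (∣ v ∣ + ∣ v′ ∣) + ∣ β ∣ * (∣ z ∣ + ∣ z′ ∣)
    difference : ∀ κ α β u v u′ v′ w z w′ z′ b b′ →
      ((κ + (α * u + β * w)) + (α * v + β * z) * b) - ((κ + (α * u′ + β * w′)) + (α * v′ + β * z′) * b′)
      ≡ α * ((u + v * b) - (u′ + v′ * b′)) + β * ((w + z * b) - (w′ + z′ * b′))
    difference = solve-∀ ℚ-ring
    factor : ∀ a m b n ε → a * (m * ε) + b * (n * ε) ≡ (a * m + b * n) * ε
    factor = solve-∀ ℚ-ring
    weaken : ∀ γ {x y} → ∣ x ∣ ≤ y → γ * x ≤ ∣ γ ∣ * y
    weaken γ {x} x≤y = ≤-trans (pq≤∣p∣∣q∣ γ x)
      (*-monoˡ-≤-nonNeg ∣ γ ∣ ⦃ nonNegative (0≤∣p∣ γ) ⦄ x≤y)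
    decide : ∀ q″ q′ → q′ < q″ → Lower G q″ → Lower G′ q ⊎ Upper G′ q′ → Lower G′ q
    decide q″ q′ q′<q″ _ (inj₁ L) = L
    decide q″ q′ q′<q″ (r₁ , r₂ , L₁ , U₂ , <₁ , <₂) (inj₂ (r₁′ , r₂′ , L₁′ , U₂′ , <₁′ , <₂′)) =
      let ε , 0<ε , small   = ∃-small c (p<q⇒0<q-p q′<q″)
          b , r₁≤b , Lb , Ub      = approximate s L₁ 0<ε
          b′ , r₁′≤b′ , Lb′ , Ub′ = approximate t L₁′ 0<ε
          hi = affine-convex-> (κ + (α * u + β * w)) (α * v + β * z) r₁≤b (<⇒≤ (Lower<Upper s Lb U₂)) <₁ <₂
          lo = affine-convex-< (κ + (α * u′ + β * w′)) (α * v′ + β * z′) r₁′≤b′ (<⇒≤ (Lower<Upper t Lb′ U₂′)) <₁′ <₂′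
          ∣A∣≤ = affine-≈-gap u v u′ v′ s t A≈ 0<ε Lb Ub Lb′ Ub′
          ∣B∣≤ = affine-≈-gap w z w′ z′ s t B≈ 0<ε Lb Ub Lb′ Ub′
      in ⊥-elim (<-irrefl refl (begin-strict
        q″ - q′                       <⟨ +-mono-< hi (neg-antimono-< lo) ⟩
        _                             ≡⟨ difference κ α β u v u′ v′ w z w′ z′ b b′ ⟩
        _                             ≤⟨ +-mono-≤ (weaken α ∣A∣≤) (weaken β ∣B∣≤) ⟩
        _                             ≡⟨ factor (∣ α ∣) (∣ v ∣ + ∣ v′ ∣) (∣ β ∣) (∣ z ∣ + ∣ z′ ∣) ε ⟩
        c * ε                         <⟨ small ⟩
        q″ - q′                       ∎))
      where open ≤-Reasoning

  -- A form `κ + α x + β y` restricted to a segment interpolates between its end values, so the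
  -- comparison can be expressed by the end values alone.
  interpolant-≤ : ∀ κ α β {a b c d a′ b′ c′ d′ k l k′ l′} s t →
    k ≡ κ + (α * a + β * b) → l ≡ κ + (α * c + β * d) →
    k′ ≡ κ + (α * a′ + β * b′) → l′ ≡ κ + (α * c′ + β * d′) →
    affine a (c - a) s ≈ℝ affine a′ (c′ - a′) t → affine b (d - b) s ≈ℝ affine b′ (d′ - b′) t →
    affine k (l - k) s ≤ℝ affine k′ (l′ - k′) t
  interpolant-≤ κ α β {a} {b} {c} {d} {a′} {b′} {c′} {d′} s t refl refl refl refl A≈ B≈ =
    subst₂ (λ v v′ → affine (κ + (α * a + β * b)) v s ≤ℝ affine (κ + (α * a′ + β * b′)) v′ t)
      (slope κ α β a b c d) (slope κ α β a′ b′ c′ d′)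
      (affine-combine-≤ κ α β {a} {c - a} {a′} {c′ - a′} {b} {d - b} {b′} {d′ - b′} s t A≈ B≈)
    where
    slope : ∀ κ α β a b c d → α * (c - a) + β * (d - b) ≡ (κ + (α * c + β * d)) - (κ + (α * a + β * b))
    slope = solve-∀ ℚ-ring

  u+v*0≡u : ∀ u v → u + v * 0ℚ ≡ u
  u+v*0≡u = solve-∀ ℚ-ring

  u+v*1≡u+v : ∀ u v → u + v * 1ℚ ≡ u + v
  u+v*1≡u+v = solve-∀ ℚ-ring

  Lower<1 : ∀ (t : UnitInterval) {r} → Lower (proj₁ t) r → r < 1ℚ
  Lower<1 (t , _ , t≤1) = t≤1 _

  0<Upper : ∀ (t : UnitInterval) {r} → Upper (proj₁ t) r → 0ℚ < r
  0<Upper (t , 0≤t , _) = ≤ℝ⇒Upper 0ℝ t 0≤t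

  affine-nonPos : ∀ {u v} (t : UnitInterval) → u ≤ 0ℚ → u + v ≤ 0ℚ → ∀ {q} → Lower (affine u v (proj₁ t)) q → q < 0ℚ
  -- A bracket of a parameter may stick out of the unit interval. Either it contains 0, or its left
  -- end lies in the unit interval.
  affine-nonPos {u} {v} t u≤0 u+v≤0 (r₁ , r₂ , L₁ , U₂ , q<₁ , q<₂) with ≤-total r₁ 0ℚ
  ... | inj₁ r₁≤0 = <-≤-trans (subst (_ <_) (u+v*0≡u u v) (affine-convex-> u v r₁≤0 (<⇒≤ (0<Upper t U₂)) q<₁ q<₂)) u≤0
  ... | inj₂ 0≤r₁ = <-≤-trans q<₁ at-r₁
    where
    at-r₁ : u + v * r₁ ≤ 0ℚ
    at-r₁ with ≤-total 0ℚ v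
    ... | inj₁ 0≤v = ≤-trans (+-monoʳ-≤ u (*-monoˡ-≤-nonNeg v ⦃ nonNegative 0≤v ⦄ (<⇒≤ (Lower<1 t L₁))))
                             (subst (_≤ 0ℚ) (sym (u+v*1≡u+v u v)) u+v≤0)
    ... | inj₂ v≤0 = ≤-trans (+-monoʳ-≤ u (*-monoˡ-≤-nonPos v ⦃ nonPositive v≤0 ⦄ 0≤r₁))
                             (subst (_≤ 0ℚ) (sym (u+v*0≡u u v)) u≤0)

  -- Positivity needs a margin: `m` is below both end values, hence below all values on the unit
  -- interval, so locating the real between 0 and `m` can only answer that 0 is below it.
  affine-pos : ∀ {u v} (t : UnitInterval) → 0ℚ < u → 0ℚ < u + v → Lower (affine u v (proj₁ t)) 0ℚ
  affine-pos {u} {v} t 0<u 0<u+v =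
    let m , 0<m , m< = <-dense (⊓-> 0<u 0<u+v)
    in decide m (<-≤-trans m< (p⊓q≤p u (u + v))) (<-≤-trans m< (p⊓q≤q u (u + v)))
         (ℝ.located (affine u v (proj₁ t)) 0ℚ m 0<m)
    where
    decide : ∀ m → m < u → m < u + v → Lower (affine u v (proj₁ t)) 0ℚ ⊎ Upper (affine u v (proj₁ t)) m →
             Lower (affine u v (proj₁ t)) 0ℚ
    decide m m<u m<u+v (inj₁ L) = L
    decide m m<u m<u+v (inj₂ (r₁ , r₂ , L₁ , U₂ , <m₁ , <m₂)) with ≤-total r₁ 0ℚ
    ... | inj₁ r₁≤0 = contradiction
            (subst (_< m) (u+v*0≡u u v) (affine-convex-< u v r₁≤0 (<⇒≤ (0<Upper t U₂)) <m₁ <m₂))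
            (<-asym m<u)
    ... | inj₂ 0≤r₁ = contradiction
            (affine-convex-> u v 0≤r₁ (<⇒≤ (Lower<1 t L₁))
              (subst (m <_) (sym (u+v*0≡u u v)) m<u) (subst (m <_) (sym (u+v*1≡u+v u v)) m<u+v))
            (<-asym <m₁)

  -- The slope is positive, so a positive rational below `t` would begin a bracket with positive
  -- values at both ends. Refuting positivity thus leaves no positive rational below `t`.
  affine-zero-start : ∀ {u v} (t : UnitInterval) → u ≡ 0ℚ → 0ℚ < u + v →
    ¬ Lower (affine u v (proj₁ t)) 0ℚ → proj₁ t ≈ℝ 0ℝ
  affine-zero-start {u} {v} (t , 0≤t , _) refl 0<0+v ¬L = t≤0 , 0≤t
    where
    0<v : 0ℚ < v
    0<v = subst (0ℚ <_) (+-identityˡ v) 0<0+v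
    0<at : ∀ {r} → 0ℚ < r → 0ℚ < 0ℚ + v * r
    0<at {r} 0<r = subst (0ℚ <_) (sym (+-identityˡ (v * r))) (*-pos 0<v 0<r)
    t≤0 : t ≤ℝ 0ℝ
    t≤0 q Lq = ≰⇒> λ 0≤q →
      let r , q<r , Lr = Equivalence.to (ℝ.lower-rounded t q) Lq
          h , Uh       = ℝ.upper-inhabited t
          0<r          = ≤-<-trans 0≤q q<r
      in ¬L (r , h , Lr , Uh , 0<at 0<r , 0<at (<-trans 0<r (Lower<Upper t Lr Uh)))

  affine-zero-end : ∀ {u v} (t : UnitInterval) → 0ℚ < u → u + v ≡ 0ℚ →
    ¬ Lower (affine u v (proj₁ t)) 0ℚ → proj₁ t ≈ℝ 1ℝ
  affine-zero-end {u} {v} (t , _ , t≤1) 0<u u+v≡0 ¬L = t≤1 , 1≤t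
    where
    regroup : ∀ u v r → u + v * r ≡ u * (1ℚ - r) + (u + v) * r
    regroup = solve-∀ ℚ-ring
    drop-0 : ∀ a r → a + 0ℚ * r ≡ a
    drop-0 = solve-∀ ℚ-ring
    0<at : ∀ {r} → r < 1ℚ → 0ℚ < u + v * r
    0<at {r} r<1 = subst (0ℚ <_)
      (sym (trans (regroup u v r) (trans (cong (λ w → u * (1ℚ - r) + w * r) u+v≡0) (drop-0 _ r))))
      (*-pos 0<u (p<q⇒0<q-p r<1))
    1≤t : 1ℝ ≤ℝ t
    1≤t q q<1 with <-dense q<1
    ... | q′ , q<q′ , q′<1 with ℝ.located t q q′ q<q′
    ... | inj₁ Lq = Lq
    ... | inj₂ Uq′ = let l , Ll = ℝ.lower-inhabited t in
      ⊥-elim (¬L (l , q′ , Ll , Uq′ , 0<at (<-trans (Lower<Upper t Ll Uq′) q′<1) , 0<at q′<1))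

  -- The brackets that witness the two bounds at `t` witness them for every parameter inside both,
  -- so their intersection is the required neighbourhood.
  affine-continuous : ∀ u v → Continuous (λ t → affine u v (proj₁ t))
  affine-continuous u v t p q ((r₁ , r₂ , L₁ , U₂ , p<₁ , p<₂) , (s₁ , s₂ , L₁′ , U₂′ , <q₁ , <q₂)) =
    r₁ ⊔ s₁ , r₂ ⊓ s₂ , (Lower-⊔ (proj₁ t) L₁ L₁′ , Upper-⊓ (proj₁ t) U₂ U₂′) ,
    λ (w , _) (Lw , Uw) →
      (r₁ , r₂ , Lower-closed-≤ w (p≤p⊔q r₁ s₁) Lw , Upper-closed-≤ w (p⊓q≤p r₂ s₂) Uw , p<₁ , p<₂) ,
      (s₁ , s₂ , Lower-closed-≤ w (p≤q⊔p r₁ s₁) Lw , Upper-closed-≤ w (p⊓q≤q r₂ s₂) Uw , <q₁ , <q₂)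

  affine-increasing : ∀ u {v} → 0ℚ < v → ∀ s t → s <ℝ t → affine u v s <ℝ affine u v t
  affine-increasing u {v} 0<v s t (q , Uq , Lq) =
    let q′ , q′<q , Uq′ = Equivalence.to (ℝ.upper-rounded s q) Uq
        l , Ll          = ℝ.lower-inhabited s
        h , Uh          = ℝ.upper-inhabited t
        k , <k , k<     = <-dense (mono q′<q)
    in k , (l , q′ , Ll , Uq′ , <-trans (mono (Lower<Upper s Ll Uq′)) <k , <k)
         , (q , h , Lq , Uh , k< , <-trans k< (mono (Lower<Upper t Lq Uh)))
    where
    mono : ∀ {a b} → a < b → u + v * a < u + v * b
    mono a<b = +-monoʳ-< u (*-monoʳ-<-pos v ⦃ positive 0<v ⦄ a<b)

  ≈ℝ-sym : ∀ x y → x ≈ℝ y → y ≈ℝ x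
  ≈ℝ-sym x y (a , b) = b , a

  ≈ℝ-trans : ∀ x y z → x ≈ℝ y → y ≈ℝ z → x ≈ℝ z
  ≈ℝ-trans x y z (a , b) (c , d) = (λ q l → c q (a q l)) , (λ q l → b q (d q l))

  fromℚ-≤⁻¹ : ∀ {p q} → fromℚ p ≤ℝ fromℚ q → p ≤ q
  fromℚ-≤⁻¹ {p} {q} p≤q = ≮⇒≥ λ q<p → let r , q<r , r<p = <-dense q<p in <-asym q<r (p≤q r r<p)

  fromℚ-injective : ∀ {p q} → fromℚ p ≈ℝ fromℚ q → p ≡ q
  fromℚ-injective (a , b) = ≤-antisym (fromℚ-≤⁻¹ a) (fromℚ-≤⁻¹ b)

-- Straight segments between integer points and separating lines

module Plane where
  open Reals
  open import Data.Empty using (⊥; ⊥-elim)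
  open import Data.Integer.Base as ℤ using (ℤ; +_; 0ℤ)
  import Data.Integer.Properties as ℤₚ
  open import Data.Product using (∃-syntax; _×_; _,_; proj₁; proj₂)
  open import Data.Product.Properties using (≡-dec)
  open import Data.Rational.Base as ℚ using (ℚ; 0ℚ; 1ℚ)
  import Data.Rational.Properties as ℚₚ
  open import Data.Sum.Base as Sum using (_⊎_; inj₁; inj₂)
  open import Function.Base using (_∘_)
  open import Relation.Binary.Definitions using (DecidableEquality)
  open import Relation.Binary.PropositionalEquality
  open import Relation.Nullary.Decidable using (Dec; _×-dec_; _⊎-dec_)
  open import Relation.Nullary.Negation using (¬_)
  open import Tactic.RingSolver using (solve-∀)

  ℤ² : Set
  ℤ² = ℤ × ℤ

  infix 4 _≟²_
  _≟²_ : DecidableEquality ℤ²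
  _≟²_ = ≡-dec ℤₚ._≟_ ℤₚ._≟_

  record AffineForm : Set where
    constructor _·x+_·y+_
    field α β κ : ℤ

  value : AffineForm → ℤ² → ℤ
  value (α ·x+ β ·y+ κ) (x , y) = κ ℤ.+ (α ℤ.* x ℤ.+ β ℤ.* y)

  -- The second segment may touch the zero line of g only in an endpoint of the first segment.
  Meets : AffineForm → (p₁ p₂ q₁ q₂ : ℤ²) → Set
  Meets g p₁ p₂ q₁ q₂ =
    (0ℤ ℤ.< value g q₁ × 0ℤ ℤ.< value g q₂) ⊎
    ((value g q₁ ≡ 0ℤ × (q₁ ≡ p₁ ⊎ q₁ ≡ p₂)) × 0ℤ ℤ.< value g q₂) ⊎
    (0ℤ ℤ.< value g q₁ × (value g q₂ ≡ 0ℤ × (q₂ ≡ p₁ ⊎ q₂ ≡ p₂)))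

  Separates : AffineForm → (p₁ p₂ q₁ q₂ : ℤ²) → Set
  Separates g p₁ p₂ q₁ q₂ = value g p₁ ℤ.≤ 0ℤ × value g p₂ ℤ.≤ 0ℤ × Meets g p₁ p₂ q₁ q₂

  separates? : ∀ g p₁ p₂ q₁ q₂ → Dec (Separates g p₁ p₂ q₁ q₂)
  separates? g p₁ p₂ q₁ q₂ =
    value g p₁ ℤₚ.≤? 0ℤ ×-dec value g p₂ ℤₚ.≤? 0ℤ ×-dec
    ((0ℤ ℤₚ.<? value g q₁ ×-dec 0ℤ ℤₚ.<? value g q₂) ⊎-dec
     ((value g q₁ ℤₚ.≟ 0ℤ ×-dec (q₁ ≟² p₁ ⊎-dec q₁ ≟² p₂)) ×-dec 0ℤ ℤₚ.<? value g q₂) ⊎-dec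
     (0ℤ ℤₚ.<? value g q₁ ×-dec (value g q₂ ℤₚ.≟ 0ℤ ×-dec (q₂ ≟² p₁ ⊎-dec q₂ ≟² p₂))))

  -- `Separates` is asymmetric, since only the second segment is kept off the zero line; either
  -- segment may play that part.
  Separable Noncrossing : (p₁ p₂ q₁ q₂ : ℤ²) → Set
  Separable p₁ p₂ q₁ q₂   = ∃[ g ] Separates g p₁ p₂ q₁ q₂
  Noncrossing p₁ p₂ q₁ q₂ = Separable p₁ p₂ q₁ q₂ ⊎ Separable q₁ q₂ p₁ p₂

  Avoids : (p₁ p₂ e : ℤ²) → Set
  Avoids p₁ p₂ e = ∃[ g ] (value g p₁ ℤ.≤ 0ℤ × value g p₂ ℤ.≤ 0ℤ × 0ℤ ℤ.< value g e)

  pointℝ : ℤ² → ℝ²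
  pointℝ (x , y) = fromℚ (ι x) , fromℚ (ι y)

  pointℝ-injective : ∀ {p q} → pointℝ p ≈ℝ² pointℝ q → p ≡ q
  pointℝ-injective (x≈ , y≈) = cong₂ _,_ (ι-injective (fromℚ-injective x≈)) (ι-injective (fromℚ-injective y≈))

  segment : ℤ² → ℤ² → UnitInterval → ℝ²
  segment (x₁ , y₁) (x₂ , y₂) (t , _) = affine (ι x₁) (ι x₂ ℚ.- ι x₁) t , affine (ι y₁) (ι y₂ ℚ.- ι y₁) t

  segment-start : ∀ p q t → proj₁ t ≈ℝ 0ℝ → segment p q t ≈ℝ² pointℝ p
  segment-start (x₁ , y₁) (x₂ , y₂) (t , _) t≈0 = at-0 (ι x₁) (ι x₂ ℚ.- ι x₁) , at-0 (ι y₁) (ι y₂ ℚ.- ι y₁)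
    where
    at-0 : ∀ u v → affine u v t ≈ℝ fromℚ u
    at-0 u v = subst (λ w → affine u v t ≈ℝ fromℚ w) (u+v*0≡u u v) (affine-at u v 0ℚ t t≈0)

  segment-end : ∀ p q t → proj₁ t ≈ℝ 1ℝ → segment p q t ≈ℝ² pointℝ q
  segment-end (x₁ , y₁) (x₂ , y₂) (t , _) t≈1 = at-1 (ι x₁) (ι x₂) , at-1 (ι y₁) (ι y₂)
    where
    total : ∀ a b → a ℚ.+ (b ℚ.- a) ℚ.* 1ℚ ≡ b
    total = solve-∀ ℚ-ring
    at-1 : ∀ a b → affine a (b ℚ.- a) t ≈ℝ fromℚ b
    at-1 a b = subst (λ w → affine a (b ℚ.- a) t ≈ℝ fromℚ w) (total a b) (affine-at a (b ℚ.- a) 1ℚ t t≈1)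

  segment-upward : ∀ p q → proj₂ p ℤ.< proj₂ q → IsUpwardCurve (segment p q) (pointℝ p) (pointℝ q)
  segment-upward p@(x₁ , y₁) q@(x₂ , y₂) p<q = record
    { x-continuous = affine-continuous (ι x₁) (ι x₂ ℚ.- ι x₁)
    ; y-continuous = affine-continuous (ι y₁) (ι y₂ ℚ.- ι y₁)
    ; starts       = segment-start p q 0ᴵ (≈ℝ-refl 0ℝ)
    ; ends         = segment-end p q 1ᴵ (≈ℝ-refl 1ℝ)
    ; y-increasing = λ s t → affine-increasing (ι y₁) (p<q⇒0<q-p (ι-mono-< p<q)) (proj₁ s) (proj₁ t)
    }

  ≈ℝ²-sym : ∀ p q → p ≈ℝ² q → q ≈ℝ² p
  ≈ℝ²-sym (x , y) (x′ , y′) (x≈ , y≈) = ≈ℝ-sym x x′ x≈ , ≈ℝ-sym y y′ y≈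

  ≈ℝ²-trans : ∀ p q r → p ≈ℝ² q → q ≈ℝ² r → p ≈ℝ² r
  ≈ℝ²-trans (x , y) (x′ , y′) (x″ , y″) (x≈ , y≈) (x≈′ , y≈′) = ≈ℝ-trans x x′ x″ x≈ x≈′ , ≈ℝ-trans y y′ y″ y≈ y≈′

  ι-value : ∀ α β κ x y → ι (value (α ·x+ β ·y+ κ) (x , y)) ≡ ι κ ℚ.+ (ι α ℚ.* ι x ℚ.+ ι β ℚ.* ι y)
  ι-value α β κ x y = trans (ι-homo-+ κ _) (cong (ι κ ℚ.+_)
    (trans (ι-homo-+ (α ℤ.* x) (β ℤ.* y)) (cong₂ ℚ._+_ (ι-homo-* α x) (ι-homo-* β y))))

  -- Evaluate `g` at the common point. Along the first segment it is never positive; along the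
  -- second it interpolates between end values that are nonnegative and not both zero. So the common
  -- point is the end where `g` vanishes, and `Meets` makes that end a shared one.
  segments-meet : ∀ g p₁ p₂ q₁ q₂ → Separates g p₁ p₂ q₁ q₂ → ∀ s t → segment p₁ p₂ s ≈ℝ² segment q₁ q₂ t →
    (segment q₁ q₂ t ≈ℝ² pointℝ q₁ × (q₁ ≡ p₁ ⊎ q₁ ≡ p₂)) ⊎
    (segment q₁ q₂ t ≈ℝ² pointℝ q₂ × (q₂ ≡ p₁ ⊎ q₂ ≡ p₂))
  segments-meet g@(α ·x+ β ·y+ κ) p₁@(x₁ , y₁) p₂@(x₂ , y₂) q₁@(x₁′ , y₁′) q₂@(x₂′ , y₂′)
    (gp₁≤0 , gp₂≤0 , meets) s t (x≈ , y≈) = conclude meets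
    where
    G : ℤ² → ℤ² → ℝ → ℝ
    G p q = affine (ι (value g p)) (ι (value g q) ℚ.- ι (value g p))
    Gq≤Gp : G q₁ q₂ (proj₁ t) ≤ℝ G p₁ p₂ (proj₁ s)
    Gq≤Gp = interpolant-≤ (ι κ) (ι α) (ι β)
      {ι x₁′} {ι y₁′} {ι x₂′} {ι y₂′} {ι x₁} {ι y₁} {ι x₂} {ι y₂} (proj₁ t) (proj₁ s)
      (ι-value α β κ x₁′ y₁′) (ι-value α β κ x₂′ y₂′) (ι-value α β κ x₁ y₁) (ι-value α β κ x₂ y₂)
      (≈ℝ-sym (affine (ι x₁) (ι x₂ ℚ.- ι x₁) (proj₁ s)) (affine (ι x₁′) (ι x₂′ ℚ.- ι x₁′) (proj₁ t)) x≈)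
      (≈ℝ-sym (affine (ι y₁) (ι y₂ ℚ.- ι y₁) (proj₁ s)) (affine (ι y₁′) (ι y₂′ ℚ.- ι y₁′) (proj₁ t)) y≈)
    total : ∀ p q → ι (value g p) ℚ.+ (ι (value g q) ℚ.- ι (value g p)) ≡ ι (value g q)
    total p q = p+q-p≡q (ι (value g p)) (ι (value g q))
    nonPos : ∀ {z} → z ℤ.≤ 0ℤ → ι z ℚ.≤ 0ℚ
    nonPos {z} z≤0 = subst (ι z ℚ.≤_) ι-0 (ι-mono-≤ z≤0)
    pos : ∀ {z} → 0ℤ ℤ.< z → 0ℚ ℚ.< ι z
    pos {z} 0<z = subst (ℚ._< ι z) ι-0 (ι-mono-< 0<z)
    ¬L : ¬ Lower (G q₁ q₂ (proj₁ t)) 0ℚ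
    ¬L L = ℚₚ.<-irrefl refl (affine-nonPos {ι (value g p₁)} {ι (value g p₂) ℚ.- ι (value g p₁)} s (nonPos gp₁≤0)
      (subst (ℚ._≤ 0ℚ) (sym (total p₁ p₂)) (nonPos gp₂≤0)) (Gq≤Gp 0ℚ L))
    pos-end : 0ℤ ℤ.< value g q₂ → 0ℚ ℚ.< ι (value g q₁) ℚ.+ (ι (value g q₂) ℚ.- ι (value g q₁))
    pos-end 0<gq₂ = subst (0ℚ ℚ.<_) (sym (total q₁ q₂)) (pos 0<gq₂)
    conclude : Meets g p₁ p₂ q₁ q₂ →
      (segment q₁ q₂ t ≈ℝ² pointℝ q₁ × (q₁ ≡ p₁ ⊎ q₁ ≡ p₂)) ⊎
      (segment q₁ q₂ t ≈ℝ² pointℝ q₂ × (q₂ ≡ p₁ ⊎ q₂ ≡ p₂))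
    conclude (inj₁ (0<gq₁ , 0<gq₂)) = ⊥-elim (¬L (affine-pos {ι (value g q₁)} {ι (value g q₂) ℚ.- ι (value g q₁)} t (pos 0<gq₁) (pos-end 0<gq₂)))
    conclude (inj₂ (inj₁ ((gq₁≡0 , shared) , 0<gq₂))) =
      inj₁ (segment-start q₁ q₂ t (affine-zero-start {ι (value g q₁)} {ι (value g q₂) ℚ.- ι (value g q₁)} t (trans (cong ι gq₁≡0) ι-0) (pos-end 0<gq₂) ¬L) , shared)
    conclude (inj₂ (inj₂ (0<gq₁ , (gq₂≡0 , shared)))) =
      inj₂ (segment-end q₁ q₂ t
        (affine-zero-end {ι (value g q₁)} {ι (value g q₂) ℚ.- ι (value g q₁)} t (pos 0<gq₁) (trans (total q₁ q₂) (trans (cong ι gq₂≡0) ι-0)) ¬L) , shared)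

  -- The point is treated as a degenerate segment; meeting it would make `e` an end of the first
  -- segment, where `g` is not positive.
  segment-avoids : ∀ p₁ p₂ e → Avoids p₁ p₂ e → ∀ s → ¬ (segment p₁ p₂ s ≈ℝ² pointℝ e)
  segment-avoids p₁ p₂ e (g , gp₁≤0 , gp₂≤0 , 0<ge) s s≈e = Sum.[ absurd ∘ proj₂ , absurd ∘ proj₂ ]′
    (segments-meet g p₁ p₂ e e (gp₁≤0 , gp₂≤0 , inj₁ (0<ge , 0<ge)) s 1ᴵ
      (≈ℝ²-trans (segment p₁ p₂ s) (pointℝ e) (segment e e 1ᴵ) s≈e
        (≈ℝ²-sym (segment e e 1ᴵ) (pointℝ e) (segment-end e e 1ᴵ (≈ℝ-refl 1ℝ)))))
    where
    absurd : e ≡ p₁ ⊎ e ≡ p₂ → ⊥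
    absurd (inj₁ refl) = ℤₚ.≤⇒≯ gp₁≤0 0<ge
    absurd (inj₂ refl) = ℤₚ.≤⇒≯ gp₂≤0 0<ge

-- Stretching the square to a box, with sign conditions for affine forms

module Boxes where
  open Plane
  open import Data.Integer.Base
  open import Data.Integer.Properties
  open import Data.Integer.Tactic.RingSolver using (solve-∀)
  import Data.Nat.Base as ℕ
  open import Data.Product using (_×_; _,_)
  open import Data.Sum.Base as Sum using (_⊎_; inj₁; inj₂)
  open import Relation.Binary.PropositionalEquality

  i≤+∣i∣ : ∀ i → i ≤ + ∣ i ∣
  i≤+∣i∣ (+ n)    = ≤-refl
  i≤+∣i∣ -[1+ n ] = -≤+

  0<-* : ∀ {i j} → 0ℤ < i → 0ℤ < j → 0ℤ < i * j
  0<-* {i} {j} 0<i 0<j = subst (_< i * j) (*-zeroʳ i) (*-monoˡ-<-pos i ⦃ positive 0<i ⦄ 0<j)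

  *-≤0 : ∀ {i j} → 0ℤ < i → j ≤ 0ℤ → i * j ≤ 0ℤ
  *-≤0 {i} {j} 0<i j≤0 = subst (i * j ≤_) (*-zeroʳ i) (*-monoˡ-≤-nonNeg i ⦃ nonNegative (<⇒≤ 0<i) ⦄ j≤0)

  αx≤∣α∣X : ∀ α {x X} → + ∣ x ∣ ≤ X → α * x ≤ + ∣ α ∣ * X
  αx≤∣α∣X α {x} {X} x≤X = begin
    α * x               ≤⟨ i≤+∣i∣ (α * x) ⟩
    + ∣ α * x ∣         ≡⟨ cong +_ (abs-* α x) ⟩
    + (∣ α ∣ ℕ.* ∣ x ∣) ≡⟨ pos-* (∣ α ∣) (∣ x ∣) ⟩
    + ∣ α ∣ * + ∣ x ∣   ≤⟨ *-monoˡ-≤-nonNeg (+ ∣ α ∣) x≤X ⟩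
    + ∣ α ∣ * X         ∎
    where open ≤-Reasoning

  InBox : ℤ → ℤ → ℤ² → Set
  InBox X Y (x , y) = + ∣ x ∣ ≤ X × + ∣ y ∣ ≤ Y

  stretch : ℤ → ℤ → ℤ² → ℤ²
  stretch X Y (x , y) = X * x , Y * y

  -- The form composed with the inverse of `stretch`, multiplied by `X * Y` to stay integral; for
  -- positive `X` and `Y` this preserves signs.
  stretchForm : ℤ → ℤ → AffineForm → AffineForm
  stretchForm X Y (α ·x+ β ·y+ κ) = (α * Y) ·x+ (β * X) ·y+ (κ * (X * Y))

  value-stretch : ∀ X Y g p → value (stretchForm X Y g) (stretch X Y p) ≡ (X * Y) * value g p
  value-stretch X Y (α ·x+ β ·y+ κ) (x , y) = identity X Y α β κ x y
    where
    identity : ∀ X Y α β κ x y → κ * (X * Y) + (α * Y * (X * x) + β * X * (Y * y)) ≡ (X * Y) * (κ + (α * x + β * y))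
    identity = solve-∀

  -- On the square [-1,1]² the linear part has extreme values plus and minus `∣ α ∣ + ∣ β ∣`,
  -- attained at corners, so the sign on the whole square is one integer inequality.
  PositiveOnBox NonPositiveOnBox : AffineForm → Set
  PositiveOnBox    (α ·x+ β ·y+ κ) = + ∣ α ∣ + + ∣ β ∣ < κ
  NonPositiveOnBox (α ·x+ β ·y+ κ) = κ + (+ ∣ α ∣ + + ∣ β ∣) ≤ 0ℤ

  module Stretched {X Y : ℤ} (0<X : 0ℤ < X) (0<Y : 0ℤ < Y) where

    0<XY : 0ℤ < X * Y
    0<XY = 0<-* 0<X 0<Y

    private instance
      X-nonNeg : NonNegative X
      X-nonNeg = nonNegative (<⇒≤ 0<X)
      Y-nonNeg : NonNegative Y
      Y-nonNeg = nonNegative (<⇒≤ 0<Y)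

    value-stretch-≤0 : ∀ g p → value g p ≤ 0ℤ → value (stretchForm X Y g) (stretch X Y p) ≤ 0ℤ
    value-stretch-≤0 g p ≤0 = subst (_≤ 0ℤ) (sym (value-stretch X Y g p)) (*-≤0 0<XY ≤0)

    value-stretch-≡0 : ∀ g p → value g p ≡ 0ℤ → value (stretchForm X Y g) (stretch X Y p) ≡ 0ℤ
    value-stretch-≡0 g p ≡0 = trans (value-stretch X Y g p) (trans (cong ((X * Y) *_) ≡0) (*-zeroʳ (X * Y)))

    value-stretch->0 : ∀ g p → 0ℤ < value g p → 0ℤ < value (stretchForm X Y g) (stretch X Y p)
    value-stretch->0 g p 0< = subst (0ℤ <_) (sym (value-stretch X Y g p)) (0<-* 0<XY 0<)

    separates-stretch : ∀ g p₁ p₂ q₁ q₂ → Separates g p₁ p₂ q₁ q₂ →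
      Separates (stretchForm X Y g) (stretch X Y p₁) (stretch X Y p₂) (stretch X Y q₁) (stretch X Y q₂)
    separates-stretch g p₁ p₂ q₁ q₂ (≤₁ , ≤₂ , meets) =
      value-stretch-≤0 g p₁ ≤₁ , value-stretch-≤0 g p₂ ≤₂ , stretched meets
      where
      shared : ∀ {q} → q ≡ p₁ ⊎ q ≡ p₂ → stretch X Y q ≡ stretch X Y p₁ ⊎ stretch X Y q ≡ stretch X Y p₂
      shared = Sum.map (cong (stretch X Y)) (cong (stretch X Y))
      stretched : Meets g p₁ p₂ q₁ q₂ →
        Meets (stretchForm X Y g) (stretch X Y p₁) (stretch X Y p₂) (stretch X Y q₁) (stretch X Y q₂)
      stretched (inj₁ (>₁ , >₂)) = inj₁ (value-stretch->0 g q₁ >₁ , value-stretch->0 g q₂ >₂)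
      stretched (inj₂ (inj₁ ((≡₁ , s) , >₂))) = inj₂ (inj₁ ((value-stretch-≡0 g q₁ ≡₁ , shared s) , value-stretch->0 g q₂ >₂))
      stretched (inj₂ (inj₂ (>₁ , (≡₂ , s)))) = inj₂ (inj₂ (value-stretch->0 g q₁ >₁ , (value-stretch-≡0 g q₂ ≡₂ , shared s)))

    noncrossing-stretch : ∀ p₁ p₂ q₁ q₂ → Noncrossing p₁ p₂ q₁ q₂ →
      Noncrossing (stretch X Y p₁) (stretch X Y p₂) (stretch X Y q₁) (stretch X Y q₂)
    noncrossing-stretch p₁ p₂ q₁ q₂ = Sum.map
      (λ (g , sep) → stretchForm X Y g , separates-stretch g p₁ p₂ q₁ q₂ sep)
      (λ (g , sep) → stretchForm X Y g , separates-stretch g q₁ q₂ p₁ p₂ sep)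

    positive-on-box : ∀ g → PositiveOnBox g → ∀ {p} → InBox X Y p → 0ℤ < value (stretchForm X Y g) p
    positive-on-box (α ·x+ β ·y+ κ) ∣α∣+∣β∣<κ {x , y} (x≤X , y≤Y) = begin-strict
      0ℤ
        ≡⟨ +-inverseʳ ((X * Y) * (+ ∣ α ∣ + + ∣ β ∣)) ⟨
      (X * Y) * (+ ∣ α ∣ + + ∣ β ∣) - (X * Y) * (+ ∣ α ∣ + + ∣ β ∣)
        <⟨ +-monoˡ-< (- ((X * Y) * (+ ∣ α ∣ + + ∣ β ∣))) (*-monoˡ-<-pos (X * Y) ⦃ positive 0<XY ⦄ ∣α∣+∣β∣<κ) ⟩
      (X * Y) * κ - (X * Y) * (+ ∣ α ∣ + + ∣ β ∣)
        ≡⟨ regroup X Y (+ ∣ α ∣) (+ ∣ β ∣) κ ⟩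
      κ * (X * Y) - (Y * (+ ∣ α ∣ * X) + X * (+ ∣ β ∣ * Y))
        ≤⟨ +-monoʳ-≤ (κ * (X * Y)) (neg-mono-≤ (+-mono-≤ (*-monoˡ-≤-nonNeg Y (bound α x≤X)) (*-monoˡ-≤-nonNeg X (bound β y≤Y)))) ⟩
      κ * (X * Y) - (Y * (- α * x) + X * (- β * y))
        ≡⟨ unfold X Y α β κ x y ⟩
      κ * (X * Y) + (α * Y * x + β * X * y)
        ∎
      where
      open ≤-Reasoning
      bound : ∀ α {x X} → + ∣ x ∣ ≤ X → - α * x ≤ + ∣ α ∣ * X
      bound α {x} {X} x≤X = subst (λ n → - α * x ≤ + n * X) (∣-i∣≡∣i∣ α) (αx≤∣α∣X (- α) x≤X)
      regroup : ∀ X Y a b κ → (X * Y) * κ - (X * Y) * (a + b) ≡ κ * (X * Y) - (Y * (a * X) + X * (b * Y))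
      regroup = solve-∀
      unfold : ∀ X Y α β κ x y → κ * (X * Y) - (Y * (- α * x) + X * (- β * y)) ≡ κ * (X * Y) + (α * Y * x + β * X * y)
      unfold = solve-∀

    nonPositive-on-box : ∀ g → NonPositiveOnBox g → ∀ {p} → InBox X Y p → value (stretchForm X Y g) p ≤ 0ℤ
    nonPositive-on-box (α ·x+ β ·y+ κ) κ+∣α∣+∣β∣≤0 {x , y} (x≤X , y≤Y) = begin
      κ * (X * Y) + (α * Y * x + β * X * y)
        ≡⟨ unfold X Y α β κ x y ⟩
      κ * (X * Y) + (Y * (α * x) + X * (β * y))
        ≤⟨ +-monoʳ-≤ (κ * (X * Y)) (+-mono-≤ (*-monoˡ-≤-nonNeg Y (αx≤∣α∣X α x≤X)) (*-monoˡ-≤-nonNeg X (αx≤∣α∣X β y≤Y))) ⟩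
      κ * (X * Y) + (Y * (+ ∣ α ∣ * X) + X * (+ ∣ β ∣ * Y))
        ≡⟨ regroup X Y (+ ∣ α ∣) (+ ∣ β ∣) κ ⟩
      (X * Y) * (κ + (+ ∣ α ∣ + + ∣ β ∣))
        ≤⟨ *-≤0 0<XY κ+∣α∣+∣β∣≤0 ⟩
      0ℤ
        ∎
      where
      open ≤-Reasoning
      regroup : ∀ X Y a b κ → κ * (X * Y) + (Y * (a * X) + X * (b * Y)) ≡ (X * Y) * (κ + (a + b))
      regroup = solve-∀
      unfold : ∀ X Y α β κ x y → κ * (X * Y) + (α * Y * x + β * X * y) ≡ κ * (X * Y) + (Y * (α * x) + X * (β * y))
      unfold = solve-∀

-- Standard examples, ranks, and existence of the dimension

module Posets where
  open import Data.Fin.Base as Fin using (Fin; zero; suc; combine; finToFun; funToFin; fromℕ<)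
  import Data.Fin.Properties as Finₚ
  open import Data.Integer.Base as ℤ using (ℤ; 0ℤ; 1ℤ)
  import Data.Integer.Properties as ℤₚ
  open import Data.Nat.Base as ℕ using (ℕ; zero; suc)
  import Data.Nat.Properties as ℕₚ
  open import Data.Product using (∃; ∃-syntax; _×_; _,_; proj₁; proj₂; map; map₂)
  open import Data.Sum.Base as Sum using (_⊎_; inj₁; inj₂)
  open import Function.Base using (_∘_; _on_)
  open import Function.Bundles using (_⇔_; mk⇔; Equivalence; Inverse)
  open import Function.Definitions using (Injective)
  open import Level using (0ℓ)
  open import Relation.Binary.Core using (Rel)
  open import Relation.Binary.Definitions using (DecidableEquality; tri<; tri≈; tri>)
  open import Relation.Binary.PropositionalEquality hiding (isPartialOrder)
  open import Relation.Binary.Structures using (IsPartialOrder; IsTotalOrder; IsTotalPreorder)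
  open import Relation.Nullary.Decidable using (Dec; yes; no; map′; _×-dec_; _⊎-dec_; _→-dec_)
  open import Relation.Nullary.Negation using (¬_; contradiction)
  open import Relation.Unary using (Pred; Decidable)

  ∀⊎∃ : ∀ {m} {Q R : Pred (Fin m) 0ℓ} → (∀ i → Q i ⊎ R i) → (∀ i → Q i) ⊎ ∃ R
  ∀⊎∃ {zero}  Q⊎R = inj₁ λ ()
  ∀⊎∃ {suc m} Q⊎R with Q⊎R zero | ∀⊎∃ (Q⊎R ∘ suc)
  ... | inj₂ r | _            = inj₂ (zero , r)
  ... | inj₁ _ | inj₂ (i , r) = inj₂ (suc i , r)
  ... | inj₁ q | inj₁ qs      = inj₁ λ { zero → q ; (suc i) → qs i }

  module _ (P : FinitePoset) where
    open FinitePoset P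
    private module ≤ = IsPartialOrder isPartialOrder

    -- That `a i` is not below `b i` must be witnessed by an order placing `b i` below `a i`, and no
    -- order can serve two indices.
    standard-example⇒dimension≥ : ∀ {n} (a b : Fin n → Carrier) →
      (∀ i j → i ≢ j → a i ≤ b j) → (∀ i → ¬ a i ≤ b i) →
      ∀ m → IsIntersectionOfLinearOrders P m → n ℕ.≤ m
    standard-example⇒dimension≥ {n} a b a≤b a≰b m (L , total , realizes) = Finₚ.injective⇒≤ reverser-injective
      where
      reversed : ∀ i → ∃[ l ] L l (b i) (a i)
      reversed i with ∀⊎∃ (λ l → IsTotalOrder.total (total l) (a i) (b i))
      ... | inj₁ all = contradiction (Equivalence.from (realizes (a i) (b i)) all) (a≰b i)
      ... | inj₂ ∃r  = ∃r
      reverser : Fin n → Fin m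
      reverser i = proj₁ (reversed i)
      -- A linear order reversing two of the pairs would be cyclic: a i < b j < a j < b i < a i
      reverser-injective : Injective _≡_ _≡_ reverser
      reverser-injective {i} {j} same with i Finₚ.≟ j
      ... | yes i≡j = i≡j
      ... | no  i≢j = contradiction (≤.reflexive (antisym aᵢ≤bᵢ (proj₂ (reversed i)))) (a≰b i)
        where
        open IsTotalOrder (total (reverser i)) using (antisym) renaming (trans to ≤-trans)
        extends : ∀ {x y} → x ≤ y → L (reverser i) x y
        extends {x} {y} x≤y = Equivalence.to (realizes x y) x≤y (reverser i)
        bⱼ≤aⱼ : L (reverser i) (b j) (a j)
        bⱼ≤aⱼ = subst (λ l → L l (b j) (a j)) (sym same) (proj₂ (reversed j))
        aᵢ≤bᵢ : L (reverser i) (a i) (b i)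
        aᵢ≤bᵢ = ≤-trans (extends (a≤b i j i≢j)) (≤-trans bⱼ≤aⱼ (extends (a≤b j i (i≢j ∘ sym))))

    rank⇒chain≤ : ∀ {h} (ρ : Carrier → ℕ) → (∀ x → ρ x ℕ.< h) → (∀ {x y} → x ≤ y → x ≢ y → ρ x ℕ.< ρ y) →
      ∀ k → HasChainOfSize P k → k ℕ.≤ h
    rank⇒chain≤ {h} ρ ρ<h ρ-mono k (c , c-injective , c-chain) = Finₚ.injective⇒≤ level-injective
      where
      level : Fin k → Fin h
      level i = fromℕ< (ρ<h (c i))
      level-injective : Injective _≡_ _≡_ level
      level-injective {i} {j} same with i Finₚ.≟ j
      ... | yes i≡j = i≡j
      ... | no  i≢j with Finₚ.fromℕ<-injective (ρ (c i)) (ρ (c j)) _ _ same | c-chain i j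
      ... | ρ≡ | inj₁ cᵢ≤cⱼ = contradiction ρ≡ (ℕₚ.<⇒≢ (ρ-mono cᵢ≤cⱼ (i≢j ∘ c-injective)))
      ... | ρ≡ | inj₂ cⱼ≤cᵢ = contradiction (sym ρ≡) (ℕₚ.<⇒≢ (ρ-mono cⱼ≤cᵢ (i≢j ∘ sym ∘ c-injective)))

  Lex : ∀ {A : Set} → (A → ℤ) → Rel A 0ℓ → Rel A 0ℓ
  Lex f R x y = f x ℤ.< f y ⊎ (f x ≡ f y × R x y)

  lex-isTotalPreorder : ∀ {A : Set} (f : A → ℤ) {R : Rel A 0ℓ} → IsTotalPreorder _≡_ R → IsTotalPreorder _≡_ (Lex f R)
  lex-isTotalPreorder {A} f {R} isTotalPreorder = record
    { isPreorder = record
      { isEquivalence = isEquivalence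
      ; reflexive     = λ { refl → inj₂ (refl , R.refl) }
      ; trans         = lex-trans
      }
    ; total = lex-total
    }
    where
    module R = IsTotalPreorder isTotalPreorder
    lex-trans : ∀ {x y z} → Lex f R x y → Lex f R y z → Lex f R x z
    lex-trans (inj₁ x<y)         (inj₁ y<z)         = inj₁ (ℤₚ.<-trans x<y y<z)
    lex-trans {x} (inj₁ x<y)     (inj₂ (y≡z , _))   = inj₁ (subst (f x ℤ.<_) y≡z x<y)
    lex-trans {z = z} (inj₂ (x≡y , _)) (inj₁ y<z)   = inj₁ (subst (ℤ._< f z) (sym x≡y) y<z)
    lex-trans (inj₂ (x≡y , xRy)) (inj₂ (y≡z , yRz)) = inj₂ (trans x≡y y≡z , R.trans xRy yRz)
    lex-total : ∀ x y → Lex f R x y ⊎ Lex f R y x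
    lex-total x y with ℤₚ.<-cmp (f x) (f y)
    ... | tri< x<y _ _ = inj₁ (inj₁ x<y)
    ... | tri> _ _ y<x = inj₂ (inj₁ y<x)
    ... | tri≈ _ x≡y _ = Sum.map (λ xRy → inj₂ (x≡y , xRy)) (λ yRx → inj₂ (sym x≡y , yRx)) (R.total x y)

  lex-antisym : ∀ {A : Set} (f : A → ℤ) (R : Rel A 0ℓ) {x y} → Lex f R x y → Lex f R y x → f x ≡ f y × R x y × R y x
  lex-antisym f R (inj₁ x<y)         (inj₁ y<x)         = contradiction y<x (ℤₚ.<-asym x<y)
  lex-antisym f R (inj₁ x<y)         (inj₂ (y≡x , _))   = contradiction (sym y≡x) (ℤₚ.<⇒≢ x<y)
  lex-antisym f R (inj₂ (x≡y , _))   (inj₁ y<x)         = contradiction (sym x≡y) (ℤₚ.<⇒≢ y<x)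
  lex-antisym f R (inj₂ (x≡y , xRy)) (inj₂ (_ , yRx))   = x≡y , xRy , yRx

  -- Constructively, an inhabited set of naturals need not have a least element at hand;
  -- decidability allows a search up to the known member.
  least : ∀ {ℓ} {S : Pred ℕ ℓ} → Decidable S → ∀ n → S n → ∃ (IsLeast S)
  least {S = S} S? n Sn with search (suc n)
    where
    search : ∀ n → (∀ m → m ℕ.< n → ¬ S m) ⊎ ∃ (IsLeast S)
    search zero = inj₁ λ _ ()
    search (suc n) with search n
    ... | inj₂ found = inj₂ found
    ... | inj₁ none with S? n
    ... | yes Sn = inj₂ (n , Sn , λ m Sm → ℕₚ.≮⇒≥ λ m<n → none m m<n Sm)
    ... | no ¬Sn = inj₁ λ m m<1+n → Sum.[ none m , (λ { refl → ¬Sn }) ]′ (ℕₚ.m≤n⇒m<n∨m≡n (ℕ.s≤s⁻¹ m<1+n))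
  ... | inj₁ none  = contradiction Sn (none n ℕₚ.≤-refl)
  ... | inj₂ found = found

  module Dimension (P : FinitePoset) (_≤?_ : ∀ x y → Dec (FinitePoset._≤_ P x y)) where
    open FinitePoset P
    private
      module ≤ = IsPartialOrder isPartialOrder
      module E = Inverse enumeration

    from-to : ∀ x → E.from (E.to x) ≡ x
    from-to x = E.inverseʳ refl

    infix 4 _≟_
    _≟_ : DecidableEquality Carrier
    x ≟ y = map′ (λ eq → trans (sym (from-to x)) (trans (cong E.from eq) (from-to y))) (cong E.to) (E.to x Finₚ.≟ E.to y)

    all? : ∀ {Q : Pred Carrier 0ℓ} → Decidable Q → Dec (∀ x → Q x)
    all? {Q} Q? = map′ (λ q x → subst Q (from-to x) (q (E.to x))) (λ q → q ∘ E.from) (Finₚ.all? (Q? ∘ E.from))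

    isTotalOrder? : ∀ {R : Rel Carrier 0ℓ} → (∀ x y → Dec (R x y)) → Dec (IsTotalOrder _≡_ R)
    isTotalOrder? {R} R? = map′
      (λ (r , t , a , c) → record
        { isPartialOrder = record
          { isPreorder = record
            { isEquivalence = isEquivalence
            ; reflexive     = λ { refl → r _ }
            ; trans         = t _ _ _
            }
          ; antisym = a _ _
          }
        ; total = c
        })
      (λ O → let open IsTotalOrder O using (antisym; total) renaming (refl to R-refl; trans to R-trans) in
        (λ _ → R-refl) , (λ _ _ _ → R-trans) , (λ _ _ → antisym) , total)
      (all? (λ x → R? x x)
        ×-dec all? (λ x → all? λ y → all? λ z → R? x y →-dec (R? y z →-dec R? x z))
        ×-dec all? (λ x → all? λ y → R? x y →-dec (R? y x →-dec (x ≟ y)))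
        ×-dec all? (λ x → all? λ y → R? x y ⊎-dec R? y x))

    Realizes : ∀ d → (Fin d → Rel Carrier 0ℓ) → Set
    Realizes d L = (∀ i → IsTotalOrder _≡_ (L i)) × (∀ x y → x ≤ y ⇔ (∀ i → L i x y))

    realizes? : ∀ d {L : Fin d → Rel Carrier 0ℓ} → (∀ i x y → Dec (L i x y)) → Dec (Realizes d L)
    realizes? d {L} L? =
      Finₚ.all? (λ i → isTotalOrder? (L? i)) ×-dec
      all? (λ x → all? λ y → map′ (λ (f , g) → mk⇔ f g) (λ e → Equivalence.to e , Equivalence.from e)
        ((x ≤? y →-dec Finₚ.all? (λ i → L? i x y)) ×-dec (Finₚ.all? (λ i → L? i x y) →-dec x ≤? y)))

    -- Relations read back from a finite table are only equivalent to the original ones, entry by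
    -- entry, so the property has to be transported along equivalences.
    realizes-resp-⇔ : ∀ {d} {L L′ : Fin d → Rel Carrier 0ℓ} → (∀ i x y → L i x y ⇔ L′ i x y) → Realizes d L → Realizes d L′
    realizes-resp-⇔ {d} {L} {L′} L⇔L′ (total , realizes) =
      (λ i → let open IsTotalOrder (total i) using () renaming (trans to L-trans; refl to L-refl; total to L-total; antisym to L-antisym) in record
        { isPartialOrder = record
          { isPreorder = record
            { isEquivalence = isEquivalence
            ; reflexive     = λ { refl → to i L-refl }
            ; trans         = λ p q → to i (L-trans (from i p) (from i q))
            }
          ; antisym = λ p q → L-antisym (from i p) (from i q)
          }
        ; total = λ x y → Sum.map (to i) (to i) (L-total x y)
        }) ,
      λ x y → mk⇔ (λ x≤y i → to i (Equivalence.to (realizes x y) x≤y i))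
                  (λ all → Equivalence.from (realizes x y) λ i → from i (all i))
      where
      to : ∀ i {x y} → L i x y → L′ i x y
      to i {x} {y} = Equivalence.to (L⇔L′ i x y)
      from : ∀ i {x y} → L′ i x y → L i x y
      from i {x} {y} = Equivalence.from (L⇔L′ i x y)

    -- One bit for each order and each pair of elements. As functions between finite sets, the
    -- tables are numbered by a finite set and can be searched.
    Table : ℕ → Set
    Table d = Fin (d ℕ.* (size ℕ.* size)) → Fin 2

    decode : ∀ {d} → Table d → Fin d → Rel Carrier 0ℓ
    decode f i x y = f (combine i (combine (E.to x) (E.to y))) ≡ suc zero

    entry : ∀ {d} → Fin (d ℕ.* (size ℕ.* size)) → Fin d × Carrier × Carrier
    entry {d} = map₂ (map E.from E.from ∘ Fin.remQuot size) ∘ Fin.remQuot {d} (size ℕ.* size)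

    entry-combine : ∀ {d} (i : Fin d) x y → entry (combine i (combine (E.to x) (E.to y))) ≡ (i , x , y)
    entry-combine i x y = begin
      entry (combine i (combine (E.to x) (E.to y)))
        ≡⟨ cong (map₂ (map E.from E.from ∘ Fin.remQuot size)) (Finₚ.remQuot-combine i (combine (E.to x) (E.to y))) ⟩
      (i , map E.from E.from (Fin.remQuot size (combine (E.to x) (E.to y))))
        ≡⟨ cong (λ xy → i , map E.from E.from xy) (Finₚ.remQuot-combine (E.to x) (E.to y)) ⟩
      (i , E.from (E.to x) , E.from (E.to y))
        ≡⟨ cong₂ (λ x y → i , x , y) (from-to x) (from-to y) ⟩
      (i , x , y)
        ∎
      where open ≡-Reasoning

    bit : ∀ {A : Set} → Dec A → Fin 2
    bit (yes _) = suc zero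
    bit (no _)  = zero

    bit⇔ : ∀ {A : Set} (A? : Dec A) → A ⇔ bit A? ≡ suc zero
    bit⇔ (yes a) = mk⇔ (λ _ → refl) (λ _ → a)
    bit⇔ (no ¬a) = mk⇔ (λ a → contradiction a ¬a) λ ()

    encode : ∀ {d} {L : Fin d → Rel Carrier 0ℓ} → (∀ i x y → Dec (L i x y)) → Table d
    encode L? k = let i , x , y = entry k in bit (L? i x y)

    decode-encode : ∀ {d} {L : Fin d → Rel Carrier 0ℓ} (L? : ∀ i x y → Dec (L i x y)) →
      ∀ i x y → L i x y ⇔ decode (finToFun (funToFin (encode L?))) i x y
    decode-encode {d} {L} L? i x y = subst (λ b → L i x y ⇔ b ≡ suc zero) (sym lookup) (bit⇔ (L? i x y))
      where
      k = combine i (combine (E.to x) (E.to y))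
      lookup : finToFun (funToFin (encode L?)) k ≡ bit (L? i x y)
      lookup = trans (Finₚ.finToFun-funToFin (encode L?) k)
        (cong (λ (i , x , y) → bit (L? i x y)) (entry-combine i x y))

    -- The quantifier ranges over arbitrary relations, but a total order on a finite set is
    -- decidable: totality offers one direction, and antisymmetry with decidable equality settles
    -- the other. So searching all tables of bits is exhaustive.
    isIntersectionOfLinearOrders? : Decidable (IsIntersectionOfLinearOrders P)
    isIntersectionOfLinearOrders? d = map′
      (λ (k , realizes) → decode (finToFun k) , realizes)
      (λ (L , realizes) → let L? = linear? L (proj₁ realizes) in
        funToFin (encode L?) , realizes-resp-⇔ (decode-encode L?) realizes)
      (Finₚ.any? λ k → realizes? d λ i x y → finToFun k (combine i (combine (E.to x) (E.to y))) Finₚ.≟ suc zero)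
      where
      linear? : ∀ (L : Fin d → Rel Carrier 0ℓ) → (∀ i → IsTotalOrder _≡_ (L i)) → ∀ i x y → Dec (L i x y)
      linear? L total i x y with IsTotalOrder.total (total i) x y
      ... | inj₁ x≤y = yes x≤y
      ... | inj₂ y≤x with x ≟ y
      ... | yes refl = yes y≤x
      ... | no  x≢y  = no λ x≤y → x≢y (IsTotalOrder.antisym (total i) x≤y y≤x)

    module _ (f g : Carrier → ℤ) (fg-injective : ∀ {x y} → f x ≡ f y → g x ≡ g y → x ≡ y)
             (f-mono : ∀ {x y} → x ≤ y → x ≢ y → f x ℤ.< f y) where

      above : Carrier → Carrier → ℤ
      above z x with z ≤? x
      ... | yes _ = 1ℤ
      ... | no  _ = 0ℤ

      -- In the application `f` and `g` are the y- and x-coordinates of a drawing; reading it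
      -- upwards, and each horizontal line from left to right, gives a linear extension.
      base : Rel Carrier 0ℓ
      base = Lex f (ℤ._≤_ on g)

      base-isTotalPreorder : IsTotalPreorder _≡_ base
      base-isTotalPreorder = lex-isTotalPreorder f record
        { isPreorder = record
          { isEquivalence = isEquivalence
          ; reflexive     = λ { refl → ℤₚ.≤-refl }
          ; trans         = ℤₚ.≤-trans
          }
        ; total = λ x y → ℤₚ.≤-total (g x) (g y)
        }

      base-antisym : ∀ {x y} → base x y → base y x → x ≡ y
      base-antisym xy yx = let f≡ , g≤ , g≥ = lex-antisym f (ℤ._≤_ on g) xy yx in fg-injective f≡ (ℤₚ.≤-antisym g≤ g≥)

      ≤⇒base : ∀ {x y} → x ≤ y → base x y
      ≤⇒base {x} {y} x≤y with x ≟ y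
      ... | yes refl = IsTotalPreorder.refl base-isTotalPreorder
      ... | no  x≢y  = inj₁ (f-mono x≤y x≢y)

      -- The linear extension that puts everything not above z first; these realize the order
      -- because z ≰ x is witnessed by the extension for z itself.
      promote : Carrier → Rel Carrier 0ℓ
      promote z = Lex (above z) base

      promote-isTotalOrder : ∀ z → IsTotalOrder _≡_ (promote z)
      promote-isTotalOrder z = record
        { isPartialOrder = record
          { isPreorder = IsTotalPreorder.isPreorder lexed
          ; antisym    = λ xy yx → let _ , b , b′ = lex-antisym (above z) base xy yx in base-antisym b b′
          }
        ; total = IsTotalPreorder.total lexed
        }
        where lexed = lex-isTotalPreorder (above z) base-isTotalPreorder

      ≤⇒promote : ∀ z {x y} → x ≤ y → promote z x y
      ≤⇒promote z {x} {y} x≤y with z ≤? x | z ≤? y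
      ... | yes _   | yes _   = inj₂ (refl , ≤⇒base x≤y)
      ... | no  _   | no  _   = inj₂ (refl , ≤⇒base x≤y)
      ... | no  _   | yes _   = inj₁ (ℤ.+<+ (ℕ.s≤s ℕ.z≤n))
      ... | yes z≤x | no z≰y  = contradiction (≤.trans z≤x x≤y) z≰y

      promote⇒≤ : ∀ {x y} → promote x x y → x ≤ y
      promote⇒≤ {x} {y} xy with x ≤? x | x ≤? y
      ... | _       | yes x≤y = x≤y
      ... | no  x≰x | no _    = contradiction ≤.refl x≰x
      promote⇒≤ (inj₁ (ℤ.+<+ ())) | yes _ | no _
      promote⇒≤ (inj₂ (() , _))   | yes _ | no _

      isIntersectionOf-size : IsIntersectionOfLinearOrders P size
      isIntersectionOf-size =
        (λ i → promote (E.from i)) , (λ i → promote-isTotalOrder (E.from i)) ,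
        λ x y → mk⇔ (λ x≤y i → ≤⇒promote (E.from i) x≤y)
                    (λ all → promote⇒≤ (subst (λ z → promote z x y) (from-to x) (all (E.to x))))

      dimension : ∃ (HasDimension P)
      dimension = least isIntersectionOfLinearOrders? size isIntersectionOf-size

-- Frames, their finite certificates, and the two concrete ones

module Frames where
  open Plane
  open Boxes
  open import Data.Bool.Base using (Bool; true; false; T; _∨_; _∧_)
  import Data.Bool.Properties as Boolₚ
  open import Data.Fin.Base using (Fin; zero; suc)
  open import Data.Fin using (#_)
  import Data.Fin.Properties as Finₚ
  open import Data.Fin.Patterns
  open import Data.Integer.Base as ℤ using (ℤ; +_; -_; 0ℤ; 1ℤ; -1ℤ; ∣_∣)
  import Data.Integer.Properties as ℤₚ
  open import Data.Bool.ListAction using (any)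
  open import Data.List.Base using (List; []; _∷_)
  open import Data.Maybe.Base as Maybe using (Maybe; just; nothing; from-just; _<∣>_; _>>=_)
  import Data.Maybe.Effectful as MaybeEffectful
  open import Data.Nat.Base as ℕ using (ℕ; zero; suc)
  import Data.Nat.Properties as ℕₚ
  open import Data.Product using (∃; ∃-syntax; _×_; _,_; proj₂)
  open import Data.Product.Properties using (≡-dec)
  open import Data.Sum.Base using (_⊎_; inj₁; inj₂)
  open import Data.Vec.Base as Vec using (Vec; []; _∷_; lookup)
  open import Function.Base using (const)
  open import Level using (0ℓ)
  open import Relation.Binary.Core using (Rel)
  open import Relation.Binary.PropositionalEquality
  open import Relation.Nullary.Decidable using (Dec; yes; no; does; ¬?; T?; _×-dec_; _⊎-dec_; dec⇒maybe)
  open import Relation.Nullary.Negation using (¬_; contradiction)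

  -- `s` is the gain in height and `m` the number of new pairs. `spine` is the part below the inner
  -- `c` by which a longest chain is prolonged; `lows` and `ups` list the pairs.
  record Frame (s m : ℕ) : Set where
    field
      new edges    : ℕ
      edge         : Vec (Fin (2 ℕ.+ new) × Fin (2 ℕ.+ new)) edges
      place        : Vec ℤ² new
      width height : ℤ
      bottom top   : Fin new
      level        : Vec ℕ new
      high         : Vec Bool new
      spine        : Vec (Fin new) s
      lows ups     : Vec (Fin new) m

    Vertex : Set
    Vertex = Fin (2 ℕ.+ new)

    -- c and d belong to the inner drawing that the frame surrounds.
    c d : Vertex
    c = 0F
    d = 1F

    ν : Fin new → Vertex
    ν i = suc (suc i)

    position : Vertex → ℤ²
    position 0F            = 0ℤ , -1ℤ
    position 1F            = 0ℤ , 1ℤ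
    position (suc (suc i)) = lookup place i

    reaches : ℕ → Vertex → Vertex → Bool
    reaches zero       u v = does (u Finₚ.≟ v)
    reaches (suc fuel) u v = does (u Finₚ.≟ v) ∨
      any (λ (x , y) → does (u Finₚ.≟ x) ∧ reaches fuel y v) (Vec.toList edge)

    -- The reflexive transitive closure of the edges, as long as no path is longer than `new`;
    -- `isFrame?` checks transitivity anyway.
    infix 4 _⊑_ _⊑?_
    _⊑_ : Rel Vertex 0ℓ
    u ⊑ v = T (reaches new u v)

    _⊑?_ : ∀ u v → Dec (u ⊑ v)
    u ⊑? v = T? (reaches new u v)

    y-of : Vertex → ℤ
    y-of v = proj₂ (position v)

  -- The fields `level` and `high` describe the ranks of the new elements: `level` counts from the
  -- bottom, and for high elements from the height of the inner poset.
  record IsFrame {s m} (F : Frame s m) : Set where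
    open Frame F
    field
      ⊑-refl        : ∀ u → u ⊑ u
      ⊑-trans       : ∀ u v → u ⊑ v → ∀ w → v ⊑ w → u ⊑ w
      ⊑-upward      : ∀ u v → u ⊑ v → u ≢ v → y-of u ℤ.< y-of v
      -- A frame attaches to the inner poset only from below at `c` and from above at `d`.
      c-maximal     : ∀ v → c ⊑ v → v ≡ c
      d-minimal     : ∀ v → v ⊑ d → v ≡ d
      -- A dichotomy instead of a statement about covers: each strict comparability is drawn or has
      -- a vertex in between, which a finite search can certify.
      cover⇒edge    : ∀ u v → u ⊑ v → u ≢ v →
                      (∃[ k ] lookup edge k ≡ (u , v)) ⊎ (∃[ w ] (w ≢ u × w ≢ v × u ⊑ w × w ⊑ v))
      noncrossing   : ∀ k l → k ≢ l → let (u , v) = lookup edge k ; (u′ , v′) = lookup edge l in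
                      Noncrossing (position u) (position v) (position u′) (position v′)
      avoiding      : ∀ k w → let (u , v) = lookup edge k in
                      w ≢ u → w ≢ v → Avoids (position u) (position v) (position w)
      -- Edges into `c` or out of `d` touch the box and are exempt; the horizontal line through that
      -- point separates them from the inner drawing.
      around        : ∀ k → let (u , v) = lookup edge k in v ≢ c → u ≢ d →
                      ∃[ g ] (value g (position u) ℤ.≤ 0ℤ × value g (position v) ℤ.≤ 0ℤ × PositiveOnBox g)
      outside       : ∀ i → ∃[ g ] (0ℤ ℤ.< value g (lookup place i) × NonPositiveOnBox g)
      distinct      : ∀ u v → u ≢ v → position u ≢ position v
      inBox         : ∀ v → InBox width height (position v)
      0<width       : 0ℤ ℤ.< width
      0<height      : 0ℤ ℤ.< height
      bottom-place  : lookup place bottom ≡ (0ℤ , - height)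
      top-place     : lookup place top ≡ (0ℤ , height)
      lowest        : ∀ v → v ≢ ν bottom → - height ℤ.< y-of v
      highest       : ∀ v → v ≢ ν top → y-of v ℤ.< height
      bottom⊑c      : ν bottom ⊑ c
      d⊑top         : d ⊑ ν top
      bottom⋢top    : ¬ ν bottom ⊑ ν top
      level<        : ∀ i → lookup level i ℕ.< s
      -- High levels are counted from a positive height, so a low element may lie below a high one
      -- of equal level.
      level-mono    : ∀ i j → ν i ⊑ ν j → i ≢ j →
                      (lookup high i ≡ lookup high j × lookup level i ℕ.< lookup level j) ⊎
                      (lookup high i ≡ false × lookup high j ≡ true × lookup level i ℕ.≤ lookup level j)
      below-c       : ∀ i → ν i ⊑ c → lookup high i ≡ false
      above-d       : ∀ i → d ⊑ ν i → lookup high i ≡ true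
      spine-distinct : ∀ i j → i ≢ j → lookup spine i ≢ lookup spine j
      spine-chain   : ∀ i j → ν (lookup spine i) ⊑ ν (lookup spine j) ⊎ ν (lookup spine j) ⊑ ν (lookup spine i)
      spine⊑c       : ∀ i → ν (lookup spine i) ⊑ c
      bottom⊑spine  : ∀ i → ν bottom ⊑ ν (lookup spine i)
      low⊑c         : ∀ i → ν (lookup lows i) ⊑ c
      low⊑top       : ∀ i → ν (lookup lows i) ⊑ ν top
      bottom⊑up     : ∀ i → ν bottom ⊑ ν (lookup ups i)
      d⊑up          : ∀ i → d ⊑ ν (lookup ups i)
      low⊑up        : ∀ i j → i ≢ j → ν (lookup lows i) ⊑ ν (lookup ups j)
      low⋢up        : ∀ i → ¬ ν (lookup lows i) ⊑ ν (lookup ups i)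

  -- The tests below are sound but may miss a certificate; only their success on the two
  -- concrete frames matters.

  every : ∀ {n} {Q : Fin n → Set} → (∀ i → Maybe (Q i)) → Maybe (∀ i → Q i)
  every = Finₚ.sequence MaybeEffectful.applicative

  assuming : ∀ {A B : Set} → Dec A → Maybe B → Maybe (A → B)
  assuming (yes _) b = Maybe.map const b
  assuming (no ¬a) _ = just λ a → contradiction a ¬a

  witness : ∀ {A : Set} {Q : A → Set} → (∀ a → Dec (Q a)) → List A → Maybe (∃ Q)
  witness Q? []       = nothing
  witness Q? (a ∷ as) = Maybe.map (a ,_) (dec⇒maybe (Q? a)) <∣> witness Q? as

  -- Positive on either side of the line through p and q, above q, and below p.
  candidates : ℤ² → ℤ² → List AffineForm
  candidates (x₁ , y₁) (x₂ , y₂) = line ∷ opposite line ∷ (0ℤ ·x+ 1ℤ ·y+ (- y₂)) ∷ (0ℤ ·x+ -1ℤ ·y+ y₁) ∷ []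
    where
    α β : ℤ
    α = y₁ ℤ.- y₂
    β = x₂ ℤ.- x₁
    line : AffineForm
    line = α ·x+ β ·y+ (- (α ℤ.* x₁ ℤ.+ β ℤ.* y₁))
    opposite : AffineForm → AffineForm
    opposite (α ·x+ β ·y+ κ) = (- α) ·x+ (- β) ·y+ (- κ)

  noncrossing? : ∀ p₁ p₂ q₁ q₂ → Maybe (Noncrossing p₁ p₂ q₁ q₂)
  noncrossing? p₁ p₂ q₁ q₂ =
    Maybe.map inj₁ (witness (λ g → separates? g p₁ p₂ q₁ q₂) (candidates p₁ p₂)) <∣>
    Maybe.map inj₂ (witness (λ g → separates? g q₁ q₂ p₁ p₂) (candidates q₁ q₂))

  avoids? : ∀ p₁ p₂ e → Maybe (Avoids p₁ p₂ e)
  avoids? p₁ p₂ e = witness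
    (λ g → value g p₁ ℤₚ.≤? 0ℤ ×-dec value g p₂ ℤₚ.≤? 0ℤ ×-dec 0ℤ ℤₚ.<? value g e) (candidates p₁ p₂)

  positiveOnBox? : ∀ g → Dec (PositiveOnBox g)
  positiveOnBox? (α ·x+ β ·y+ κ) = + ∣ α ∣ ℤ.+ + ∣ β ∣ ℤₚ.<? κ

  nonPositiveOnBox? : ∀ g → Dec (NonPositiveOnBox g)
  nonPositiveOnBox? (α ·x+ β ·y+ κ) = κ ℤ.+ (+ ∣ α ∣ ℤ.+ + ∣ β ∣) ℤₚ.≤? 0ℤ

  around? : ∀ p q → Maybe (∃[ g ] (value g p ℤ.≤ 0ℤ × value g q ℤ.≤ 0ℤ × PositiveOnBox g))
  around? p q = witness
    (λ g → value g p ℤₚ.≤? 0ℤ ×-dec value g q ℤₚ.≤? 0ℤ ×-dec positiveOnBox? g) (candidates p q)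

  outside? : ∀ p → Maybe (∃[ g ] (0ℤ ℤ.< value g p × NonPositiveOnBox g))
  outside? p = witness (λ g → 0ℤ ℤₚ.<? value g p ×-dec nonPositiveOnBox? g)
    ((1ℤ ·x+ 0ℤ ·y+ -1ℤ) ∷ (-1ℤ ·x+ 0ℤ ·y+ -1ℤ) ∷ (0ℤ ·x+ 1ℤ ·y+ -1ℤ) ∷ (0ℤ ·x+ -1ℤ ·y+ -1ℤ) ∷ [])

  inBox? : ∀ X Y p → Dec (InBox X Y p)
  inBox? X Y (x , y) = + ∣ x ∣ ℤₚ.≤? X ×-dec + ∣ y ∣ ℤₚ.≤? Y

  isFrame? : ∀ {s m} (F : Frame s m) → Maybe (IsFrame F)
  isFrame? F = do
    ⊑-refl        ← every λ u → dec⇒maybe (u ⊑? u)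
    ⊑-trans       ← every λ u → every λ v → assuming (u ⊑? v) (every λ w → assuming (v ⊑? w) (dec⇒maybe (u ⊑? w)))
    ⊑-upward      ← every λ u → every λ v → assuming (u ⊑? v) (assuming (¬? (u Finₚ.≟ v)) (dec⇒maybe (y-of u ℤₚ.<? y-of v)))
    c-maximal     ← every λ v → assuming (c ⊑? v) (dec⇒maybe (v Finₚ.≟ c))
    d-minimal     ← every λ v → assuming (v ⊑? d) (dec⇒maybe (v Finₚ.≟ d))
    cover⇒edge    ← every λ u → every λ v → assuming (u ⊑? v) (assuming (¬? (u Finₚ.≟ v))
                      (dec⇒maybe (Finₚ.any? (λ k → ≡-dec Finₚ._≟_ Finₚ._≟_ (lookup edge k) (u , v)) ⊎-dec
                        Finₚ.any? (λ w → ¬? (w Finₚ.≟ u) ×-dec ¬? (w Finₚ.≟ v) ×-dec u ⊑? w ×-dec w ⊑? v))))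
    noncrossing   ← every λ k → every λ l → assuming (¬? (k Finₚ.≟ l))
                      (let (u , v) = lookup edge k ; (u′ , v′) = lookup edge l in
                       noncrossing? (position u) (position v) (position u′) (position v′))
    avoiding      ← every λ k → every λ w → let (u , v) = lookup edge k in
                      assuming (¬? (w Finₚ.≟ u)) (assuming (¬? (w Finₚ.≟ v)) (avoids? (position u) (position v) (position w)))
    around        ← every λ k → let (u , v) = lookup edge k in
                      assuming (¬? (v Finₚ.≟ c)) (assuming (¬? (u Finₚ.≟ d)) (around? (position u) (position v)))
    outside       ← every λ i → outside? (lookup place i)
    distinct      ← every λ u → every λ v → assuming (¬? (u Finₚ.≟ v)) (dec⇒maybe (¬? (position u ≟² position v)))
    inBox         ← every λ v → dec⇒maybe (inBox? width height (position v))
    0<width       ← dec⇒maybe (0ℤ ℤₚ.<? width)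
    0<height      ← dec⇒maybe (0ℤ ℤₚ.<? height)
    bottom-place  ← dec⇒maybe (lookup place bottom ≟² (0ℤ , - height))
    top-place     ← dec⇒maybe (lookup place top ≟² (0ℤ , height))
    lowest        ← every λ v → assuming (¬? (v Finₚ.≟ ν bottom)) (dec⇒maybe (- height ℤₚ.<? y-of v))
    highest       ← every λ v → assuming (¬? (v Finₚ.≟ ν top)) (dec⇒maybe (y-of v ℤₚ.<? height))
    bottom⊑c      ← dec⇒maybe (ν bottom ⊑? c)
    d⊑top         ← dec⇒maybe (d ⊑? ν top)
    bottom⋢top    ← dec⇒maybe (¬? (ν bottom ⊑? ν top))
    level<        ← every λ i → dec⇒maybe (lookup level i ℕₚ.<? _)
    level-mono    ← every λ i → every λ j → assuming (ν i ⊑? ν j) (assuming (¬? (i Finₚ.≟ j)) (dec⇒maybe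
                      ((lookup high i Boolₚ.≟ lookup high j ×-dec lookup level i ℕₚ.<? lookup level j) ⊎-dec
                       (lookup high i Boolₚ.≟ false ×-dec lookup high j Boolₚ.≟ true ×-dec lookup level i ℕₚ.≤? lookup level j))))
    below-c       ← every λ i → assuming (ν i ⊑? c) (dec⇒maybe (lookup high i Boolₚ.≟ false))
    above-d       ← every λ i → assuming (d ⊑? ν i) (dec⇒maybe (lookup high i Boolₚ.≟ true))
    spine-distinct ← every λ i → every λ j → assuming (¬? (i Finₚ.≟ j)) (dec⇒maybe (¬? (lookup spine i Finₚ.≟ lookup spine j)))
    spine-chain   ← every λ i → every λ j → dec⇒maybe
                      (ν (lookup spine i) ⊑? ν (lookup spine j) ⊎-dec ν (lookup spine j) ⊑? ν (lookup spine i))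
    spine⊑c       ← every λ i → dec⇒maybe (ν (lookup spine i) ⊑? c)
    bottom⊑spine  ← every λ i → dec⇒maybe (ν bottom ⊑? ν (lookup spine i))
    low⊑c         ← every λ i → dec⇒maybe (ν (lookup lows i) ⊑? c)
    low⊑top       ← every λ i → dec⇒maybe (ν (lookup lows i) ⊑? ν top)
    bottom⊑up     ← every λ i → dec⇒maybe (ν bottom ⊑? ν (lookup ups i))
    d⊑up          ← every λ i → dec⇒maybe (d ⊑? ν (lookup ups i))
    low⊑up        ← every λ i → every λ j → assuming (¬? (i Finₚ.≟ j)) (dec⇒maybe (ν (lookup lows i) ⊑? ν (lookup ups j)))
    low⋢up        ← every λ i → dec⇒maybe (¬? (ν (lookup lows i) ⊑? ν (lookup ups i)))
    just record
      { ⊑-refl = ⊑-refl ; ⊑-trans = ⊑-trans ; ⊑-upward = ⊑-upward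
      ; c-maximal = c-maximal ; d-minimal = d-minimal ; cover⇒edge = cover⇒edge
      ; noncrossing = noncrossing ; avoiding = avoiding ; around = around ; outside = outside
      ; distinct = distinct ; inBox = inBox ; 0<width = 0<width ; 0<height = 0<height
      ; bottom-place = bottom-place ; top-place = top-place ; lowest = lowest ; highest = highest
      ; bottom⊑c = bottom⊑c ; d⊑top = d⊑top ; bottom⋢top = bottom⋢top
      ; level< = level< ; level-mono = level-mono ; below-c = below-c ; above-d = above-d
      ; spine-distinct = spine-distinct ; spine-chain = spine-chain
      ; spine⊑c = spine⊑c ; bottom⊑spine = bottom⊑spine
      ; low⊑c = low⊑c ; low⊑top = low⊑top ; bottom⊑up = bottom⊑up ; d⊑up = d⊑up
      ; low⊑up = low⊑up ; low⋢up = low⋢up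
      }
    where
    open Frame F

  -- The new elements are c′, d′, a, b; as vertices their indices are shifted by 2.
  kellyFrame : Frame 1 1
  kellyFrame = record
    { new    = 4
    ; edges  = 6
    ; edge   = (2F , 0F) ∷ (1F , 3F) ∷ (4F , 0F) ∷ (4F , 3F) ∷ (2F , 5F) ∷ (1F , 5F) ∷ []
    ; place  = (0ℤ , - + 16) ∷ (0ℤ , + 16) ∷ (+ 2 , - + 2) ∷ (- + 2 , + 2) ∷ []
    ; width  = + 2
    ; height = + 16
    ; bottom = 0F
    ; top    = 1F
    ; level  = 0 ∷ 0 ∷ 0 ∷ 0 ∷ []
    ; high   = false ∷ true ∷ false ∷ true ∷ []
    ; spine  = 0F ∷ []
    ; lows   = 2F ∷ []
    ; ups    = 3F ∷ []
    }

  kellyFrame-isFrame : IsFrame kellyFrame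
  kellyFrame-isFrame = from-just (isFrame? kellyFrame)

  -- The pairs 3, 4 lie in an inner layer around [-1,1]² bounded by c₁ and d₁; the outer layer
  -- with the pairs 1, 2 is its mirror image in the x-axis with a and b exchanged, stretched by
  -- 3 in x and 16 in y.
  doubleFrame : Frame 3 4
  doubleFrame = record
    { new    = 16
    ; edges  = 26
    ; edge   = Vec.map (λ (x , y) → suc (suc x) , suc (suc y))
        ( (c₂ , z) ∷ (c₂ , w) ∷ (z , c₁) ∷ (w , c₁) ∷ (d₁ , d₂)
        ∷ (a₁ , z) ∷ (a₁ , d₂) ∷ (a₂ , w) ∷ (a₂ , d₂)
        ∷ (z , b₂) ∷ (d₁ , b₂) ∷ (w , b₁) ∷ (d₁ , b₁)
        ∷ (z′ , d₁) ∷ (w′ , d₁)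
        ∷ (z′ , b₃) ∷ (c₁ , b₃) ∷ (w′ , b₄) ∷ (c₁ , b₄)
        ∷ (a₄ , z′) ∷ (a₃ , w′) ∷ [])
        Vec.++ (suc (suc c₁) , 0F) ∷ (suc (suc a₃) , 0F) ∷ (suc (suc a₄) , 0F)
             ∷ (1F , suc (suc z′)) ∷ (1F , suc (suc w′)) ∷ []
    -- The segment from `c₁` to `b₃` must pass to the right of `a₄`; from the point (0,-y) it does
    -- so exactly when y exceeds 12, and 16 is such a value. The factors 3 and 16 of the outer layer
    -- are the half-width and half-height of the inner one.
    ; place  = (0ℤ , - + 256) ∷ (0ℤ , + 256)
             ∷ (+ 6 , - + 32) ∷ (- + 6 , - + 32)
             ∷ (+ 2 , + 2) ∷ (- + 2 , + 2)
             ∷ (0ℤ , - + 16) ∷ (0ℤ , + 16)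
             ∷ (+ 9 , - + 48) ∷ (- + 9 , - + 48) ∷ (- + 2 , - + 2) ∷ (+ 2 , - + 2)
             ∷ (- + 6 , + 32) ∷ (+ 6 , + 32) ∷ (+ 3 , + 3) ∷ (- + 3 , + 3) ∷ []
    ; width  = + 9
    ; height = + 256
    ; bottom = c₂
    ; top    = d₂
    -- `b₁` and `b₂` lie above `d₁` on high level 1, and `b₃` and `b₄` above `c₁` on low level 2, so
    -- all four take high level 2.
    ; level  = 0 ∷ 2 ∷ 1 ∷ 1 ∷ 0 ∷ 0 ∷ 2 ∷ 1 ∷ 0 ∷ 0 ∷ 0 ∷ 0 ∷ 2 ∷ 2 ∷ 2 ∷ 2 ∷ []
    ; high   = false ∷ true ∷ false ∷ false ∷ true ∷ true ∷ false ∷ true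
             ∷ false ∷ false ∷ false ∷ false ∷ true ∷ true ∷ true ∷ true ∷ []
    ; spine  = c₂ ∷ z ∷ c₁ ∷ []
    ; lows   = a₁ ∷ a₂ ∷ a₃ ∷ a₄ ∷ []
    ; ups    = b₁ ∷ b₂ ∷ b₃ ∷ b₄ ∷ []
    }
    where
    c₂ d₂ z w z′ w′ c₁ d₁ a₁ a₂ a₃ a₄ b₁ b₂ b₃ b₄ : Fin 16
    c₂ = # 0
    d₂ = # 1
    z  = # 2
    w  = # 3
    z′ = # 4
    w′ = # 5
    c₁ = # 6
    d₁ = # 7
    a₁ = # 8
    a₂ = # 9
    a₃ = # 10
    a₄ = # 11
    b₁ = # 12
    b₂ = # 13
    b₃ = # 14
    b₄ = # 15

  doubleFrame-isFrame : IsFrame doubleFrame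
  doubleFrame-isFrame = from-just (isFrame? doubleFrame)

-- Placing a frame around an inner drawing

module Nesting where
  open Plane
  open Boxes
  open Frames
  open import Data.Bool.Base using (Bool; true; false)
  open import Data.Fin.Base using (Fin; suc; splitAt; join)
  open import Data.Fin.Patterns
  import Data.Fin.Properties as Finₚ
  open import Data.Integer.Base as ℤ using (ℤ; +_; -_; 0ℤ; 1ℤ; -1ℤ; ∣_∣)
  import Data.Integer.Properties as ℤₚ
  open import Data.Nat.Base as ℕ using (ℕ)
  import Data.Nat.Properties as ℕₚ
  open import Data.Product using (∃-syntax; _×_; _,_; proj₁; proj₂)
  open import Data.Sum.Base as Sum using (_⊎_; inj₁; inj₂)
  open import Data.Sum.Function.Propositional using (_⊎-↔_)
  open import Data.Sum.Properties using (inj₁-injective; inj₂-injective)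
  open import Data.Vec.Base using (lookup)
  open import Function.Base using (_∘_)
  open import Function.Construct.Composition using (_↔-∘_)
  open import Function.Construct.Identity using (↔-id)
  open import Function.Construct.Symmetry using (↔-sym)
  open import Function.Definitions using (Injective)
  open import Level using (0ℓ)
  open import Relation.Binary.Core using (Rel)
  open import Relation.Binary.Definitions using (DecidableEquality)
  open import Relation.Binary.PropositionalEquality using (_≡_; _≢_; refl; sym; trans; cong; cong₂; subst; subst₂; isEquivalence)
  open import Relation.Binary.Structures using (IsPartialOrder)
  open import Relation.Nullary.Decidable using (Dec; yes; no; map′; _×-dec_)
  open import Relation.Nullary.Negation using (¬_; contradiction)

  -- The invariant of the nesting: `h` is the height, bounded by `rank` from above and `spine` from
  -- below, and `m` is the number of pairs. `c` and `d` are the only points on the lower and upper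
  -- side of the box, at the midpoints, so that a frame can dock there. The spine lies above `c`, so
  -- new elements below `c` prolong it.
  record Nested (h m : ℕ) : Set₁ where
    field
      poset : FinitePoset
    open FinitePoset poset public
    field
      _≤?_             : ∀ x y → Dec (x ≤ y)
      c d              : Carrier
      position         : Carrier → ℤ²
      width height     : ℤ
      0<width          : 0ℤ ℤ.< width
      0<height         : 0ℤ ℤ.< height
      position-c       : position c ≡ (0ℤ , - height)
      position-d       : position d ≡ (0ℤ , height)
      inBox            : ∀ x → InBox width height (position x)
      lowest           : ∀ x → x ≢ c → - height ℤ.< proj₂ (position x)
      highest          : ∀ x → x ≢ d → proj₂ (position x) ℤ.< height
      position-injective : ∀ {x y} → position x ≡ position y → x ≡ y
      upward           : ∀ {x y} → x ≤ y → x ≢ y → proj₂ (position x) ℤ.< proj₂ (position y)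
      c≰d              : ¬ c ≤ d
      noncrossing      : ∀ {a b a′ b′} → _⋖_ poset a b → _⋖_ poset a′ b′ → (a , b) ≢ (a′ , b′) →
                         Noncrossing (position a) (position b) (position a′) (position b′)
      avoiding         : ∀ {a b} e → _⋖_ poset a b → e ≢ a → e ≢ b → Avoids (position a) (position b) (position e)
      rank             : Carrier → ℕ
      rank<            : ∀ x → rank x ℕ.< h
      rank-mono        : ∀ {x y} → x ≤ y → x ≢ y → rank x ℕ.< rank y
      spine            : Fin h → Carrier
      spine-injective  : Injective _≡_ _≡_ spine
      spine-chain      : ∀ i j → spine i ≤ spine j ⊎ spine j ≤ spine i
      c≤spine          : ∀ i → c ≤ spine i
      low up           : Fin m → Carrier
      low≤d            : ∀ i → low i ≤ d
      c≤up             : ∀ i → c ≤ up i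
      low≤up           : ∀ i j → i ≢ j → low i ≤ up j
      low≰up           : ∀ i → ¬ low i ≤ up i

    infix 4 _≟_
    _≟_ : DecidableEquality Carrier
    x ≟ y = map′ position-injective (cong position) (position x ≟² position y)

    y-of : Carrier → ℤ
    y-of x = proj₂ (position x)

    -height≤y : ∀ x → - height ℤ.≤ y-of x
    -height≤y x with x ≟ c
    ... | yes refl = ℤₚ.≤-reflexive (sym (cong proj₂ position-c))
    ... | no  x≢c  = ℤₚ.<⇒≤ (lowest x x≢c)

    y≤height : ∀ x → y-of x ℤ.≤ height
    y≤height x with x ≟ d
    ... | yes refl = ℤₚ.≤-reflexive (cong proj₂ position-d)
    ... | no  x≢d  = ℤₚ.<⇒≤ (highest x x≢d)

    d≰c : ¬ d ≤ c
    d≰c d≤c with d ≟ c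
    ... | yes d≡c = c≰d (subst₂ _≤_ d≡c (sym d≡c) d≤c)
    ... | no  d≢c = ℤₚ.<-asym (lowest d d≢c) (subst (y-of d ℤ.<_) (cong proj₂ position-c) (upward d≤c d≢c))

  splitAt-injective : ∀ m {n} {i j : Fin (m ℕ.+ n)} → splitAt m i ≡ splitAt m j → i ≡ j
  splitAt-injective m {n} {i} {j} eq =
    trans (sym (Finₚ.join-splitAt m n i)) (trans (cong (join m n) eq) (Finₚ.join-splitAt m n j))

  -- With `Y` the half-height of the box, their zero lines are the horizontal lines through `c` and
  -- `d`.
  heightForm depthForm : ℤ → AffineForm
  heightForm Y = 0ℤ ·x+ 1ℤ ·y+ Y
  depthForm  Y = 0ℤ ·x+ -1ℤ ·y+ Y

  value-heightForm : ∀ Y p → value (heightForm Y) p ≡ Y ℤ.+ proj₂ p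
  value-heightForm Y (x , y) = cong (ℤ._+_ Y) (trans (ℤₚ.+-identityˡ (1ℤ ℤ.* y)) (ℤₚ.*-identityˡ y))

  value-depthForm : ∀ Y p → value (depthForm Y) p ≡ Y ℤ.- proj₂ p
  value-depthForm Y (x , y) = cong (ℤ._+_ Y) (trans (ℤₚ.+-identityˡ (-1ℤ ℤ.* y)) (ℤₚ.-1*i≡-i y))

  -i<j⇒0<i+j : ∀ {i j} → - i ℤ.< j → 0ℤ ℤ.< i ℤ.+ j
  -i<j⇒0<i+j {i} {j} lt = subst (ℤ._< i ℤ.+ j) (ℤₚ.+-inverseʳ i) (ℤₚ.+-monoʳ-< i lt)

  j<-i⇒i+j<0 : ∀ {i j} → j ℤ.< - i → i ℤ.+ j ℤ.< 0ℤ
  j<-i⇒i+j<0 {i} {j} lt = subst (i ℤ.+ j ℤ.<_) (ℤₚ.+-inverseʳ i) (ℤₚ.+-monoʳ-< i lt)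

  j<i⇒0<i-j : ∀ {i j} → j ℤ.< i → 0ℤ ℤ.< i ℤ.- j
  j<i⇒0<i-j {i} {j} lt = subst (ℤ._< i ℤ.- j) (ℤₚ.+-inverseʳ j) (ℤₚ.+-monoˡ-< (- j) lt)

  i<j⇒i-j<0 : ∀ {i j} → i ℤ.< j → i ℤ.- j ℤ.< 0ℤ
  i<j⇒i-j<0 {i} {j} lt = subst (i ℤ.- j ℤ.<_) (ℤₚ.+-inverseʳ j) (ℤₚ.+-monoˡ-< (- j) lt)

  module Surround {s m h n} {F : Frame s m} (isFrame : IsFrame F) (N : Nested h n) where
    private
      module F = Frame F
      module F′ = IsFrame isFrame
      module N = Nested N
      module N≤ = IsPartialOrder N.isPartialOrder
    open Frame F using (Vertex; ν; _⊑_)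
    open Stretched N.0<width N.0<height

    Carrier : Set
    Carrier = Fin F.new ⊎ N.Carrier

    infix 4 _≤_
    -- Mixed comparabilities pass through `c` or `d`. None can enter at `c` and leave at `d`, since
    -- that would give `c ≤ d` in the inner poset; hence the new elements keep the order of the
    -- frame.
    _≤_ : Rel Carrier 0ℓ
    inj₁ i ≤ inj₁ j = ν i ⊑ ν j
    inj₁ i ≤ inj₂ y = ν i ⊑ F.c × N.c N.≤ y
    inj₂ x ≤ inj₁ j = x N.≤ N.d × F.d ⊑ ν j
    inj₂ x ≤ inj₂ y = x N.≤ y

    ≤-refl : ∀ {x} → x ≤ x
    ≤-refl {inj₁ i} = F′.⊑-refl (ν i)
    ≤-refl {inj₂ x} = N≤.refl

    d⋢c : ¬ F.d ⊑ F.c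
    d⋢c d⊑c with F′.⊑-upward F.d F.c d⊑c (λ ())
    ... | ()

    ≤-trans : ∀ {x y z} → x ≤ y → y ≤ z → x ≤ z
    ≤-trans {inj₁ i} {inj₁ j} {inj₁ k} p q             = F′.⊑-trans (ν i) (ν j) p (ν k) q
    ≤-trans {inj₁ i} {inj₁ j} {inj₂ z} p (q , r)       = F′.⊑-trans (ν i) (ν j) p F.c q , r
    ≤-trans {inj₁ i} {inj₂ y} {inj₁ k} (p , q) (r , t) = contradiction (N≤.trans q r) N.c≰d
    ≤-trans {inj₁ i} {inj₂ y} {inj₂ z} (p , q) r       = p , N≤.trans q r
    ≤-trans {inj₂ x} {inj₁ j} {inj₁ k} (p , q) r       = p , F′.⊑-trans F.d (ν j) q (ν k) r
    ≤-trans {inj₂ x} {inj₁ j} {inj₂ z} (p , q) (r , t) = contradiction (F′.⊑-trans F.d (ν j) q F.c r) d⋢c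
    ≤-trans {inj₂ x} {inj₂ y} {inj₁ k} p (q , r)       = N≤.trans p q , r
    ≤-trans {inj₂ x} {inj₂ y} {inj₂ z} p q             = N≤.trans p q

    ≤-antisym : ∀ {x y} → x ≤ y → y ≤ x → x ≡ y
    ≤-antisym {inj₁ i} {inj₁ j} p q with i Finₚ.≟ j
    ... | yes i≡j = cong inj₁ i≡j
    ... | no  i≢j = contradiction
      (F′.⊑-upward (ν j) (ν i) q λ { refl → i≢j refl })
      (ℤₚ.<-asym (F′.⊑-upward (ν i) (ν j) p λ { refl → i≢j refl }))
    ≤-antisym {inj₁ i} {inj₂ y} (_ , c≤y) (y≤d , _) = contradiction (N≤.trans c≤y y≤d) N.c≰d
    ≤-antisym {inj₂ x} {inj₁ j} (x≤d , _) (_ , c≤x) = contradiction (N≤.trans c≤x x≤d) N.c≰d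
    ≤-antisym {inj₂ x} {inj₂ y} p q = cong inj₂ (N≤.antisym p q)

    _≤?_ : ∀ x y → Dec (x ≤ y)
    inj₁ i ≤? inj₁ j = ν i F.⊑? ν j
    inj₁ i ≤? inj₂ y = ν i F.⊑? F.c ×-dec N.c N.≤? y
    inj₂ x ≤? inj₁ j = x N.≤? N.d ×-dec F.d F.⊑? ν j
    inj₂ x ≤? inj₂ y = x N.≤? y

    poset : FinitePoset
    poset = record
      { Carrier        = Carrier
      ; _≤_            = _≤_
      ; isPartialOrder = record
        { isPreorder = record
          { isEquivalence = isEquivalence
          ; reflexive     = λ { {x} refl → ≤-refl {x} }
          ; trans         = λ {x} {y} {z} → ≤-trans {x} {y} {z}
          }
        ; antisym = ≤-antisym
        }
      ; size           = F.new ℕ.+ N.size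
      ; enumeration    = ↔-sym Finₚ.+↔⊎ ↔-∘ (↔-id (Fin F.new) ⊎-↔ N.enumeration)
      }

    port : Vertex → Carrier
    port 0F            = inj₂ N.c
    port 1F            = inj₂ N.d
    port (suc (suc i)) = inj₁ i

    port-injective : ∀ u v → port u ≡ port v → u ≡ v
    port-injective 0F 0F _ = refl
    port-injective 1F 1F _ = refl
    port-injective 0F 1F c≡d = contradiction (N≤.reflexive (inj₂-injective c≡d)) N.c≰d
    port-injective 1F 0F d≡c = contradiction (N≤.reflexive (inj₂-injective d≡c)) N.d≰c
    port-injective (suc (suc i)) (suc (suc j)) eq = cong ν (inj₁-injective eq)

    port-mono : ∀ u v → u ⊑ v → port u ≤ port v
    port-mono 0F v c⊑v rewrite F′.c-maximal v c⊑v = N≤.refl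
    port-mono 1F 0F d⊑c = contradiction d⊑c d⋢c
    port-mono 1F 1F _ = N≤.refl
    port-mono 1F (suc (suc j)) d⊑j = N≤.refl , d⊑j
    port-mono (suc (suc i)) 0F i⊑c = i⊑c , N≤.refl
    port-mono (suc (suc i)) 1F i⊑d with F′.d-minimal (ν i) i⊑d
    ... | ()
    port-mono (suc (suc i)) (suc (suc j)) i⊑j = i⊑j

    port-reflects : ∀ u v → port u ≤ port v → u ⊑ v
    port-reflects 0F 0F _ = F′.⊑-refl F.c
    port-reflects 0F 1F c≤d = contradiction c≤d N.c≰d
    port-reflects 0F (suc (suc j)) (c≤d , _) = contradiction c≤d N.c≰d
    port-reflects 1F 0F d≤c = contradiction d≤c N.d≰c
    port-reflects 1F 1F _ = F′.⊑-refl F.d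
    port-reflects 1F (suc (suc j)) (_ , d⊑j) = d⊑j
    port-reflects (suc (suc i)) 0F (i⊑c , _) = i⊑c
    port-reflects (suc (suc i)) 1F (_ , c≤d) = contradiction c≤d N.c≰d
    port-reflects (suc (suc i)) (suc (suc j)) i⊑j = i⊑j

    infix 4 _⋖′_
    _⋖′_ : Rel Carrier 0ℓ
    _⋖′_ = _⋖_ poset

    data Cover : Carrier → Carrier → Set where
      frame : ∀ k → let (u , v) = lookup F.edge k in Cover (port u) (port v)
      inner : ∀ {p q} → _⋖_ N.poset p q → Cover (inj₂ p) (inj₂ q)

    port-cover : ∀ u v → port u ⋖′ port v → Cover (port u) (port v)
    port-cover u v (u≤v , u≢v , nothing-between)
      with F′.cover⇒edge u v (port-reflects u v u≤v) (u≢v ∘ cong port)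
    ... | inj₁ (k , eq) = subst (λ (u , v) → Cover (port u) (port v)) eq (frame k)
    ... | inj₂ (w , w≢u , w≢v , u⊑w , w⊑v) = contradiction
      (port w , w≢u ∘ port-injective w u , w≢v ∘ port-injective w v , port-mono u w u⊑w , port-mono w v w⊑v)
      nothing-between

    -- A mixed comparability factors through `c` or `d`, so it can be a cover only if its inner
    -- element is that port, and then it is a cover among vertices of the frame.
    cover : ∀ {x y} → x ⋖′ y → Cover x y
    cover {inj₁ i} {inj₁ j} i⋖j = port-cover (ν i) (ν j) i⋖j
    cover {inj₁ i} {inj₂ y} i⋖y with y N.≟ N.c
    ... | yes refl = port-cover (ν i) F.c i⋖y
    ... | no  y≢c  = let (i⊑c , c≤y) , _ , nothing-between = i⋖y in contradiction
      (inj₂ N.c , (λ ()) , (λ { refl → y≢c refl }) , (i⊑c , N≤.refl) , c≤y) nothing-between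
    cover {inj₂ x} {inj₁ j} x⋖j with x N.≟ N.d
    ... | yes refl = port-cover F.d (ν j) x⋖j
    ... | no  x≢d  = let (x≤d , d⊑j) , _ , nothing-between = x⋖j in contradiction
      (inj₂ N.d , (λ { refl → x≢d refl }) , (λ ()) , x≤d , (N≤.refl , d⊑j)) nothing-between
    cover {inj₂ x} {inj₂ y} (x≤y , x≢y , nothing-between) = inner
      (x≤y , x≢y ∘ cong inj₂ , λ (z , z≢x , z≢y , x≤z , z≤y) →
        nothing-between (inj₂ z , z≢x ∘ inj₂-injective , z≢y ∘ inj₂-injective , x≤z , z≤y))

    width height : ℤ
    width  = N.width ℤ.* F.width
    height = N.height ℤ.* F.height

    enlarge : ℤ² → ℤ²
    enlarge = stretch N.width N.height

    position : Carrier → ℤ²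
    position (inj₁ i) = enlarge (lookup F.place i)
    position (inj₂ x) = N.position x

    y-of : Carrier → ℤ
    y-of x = proj₂ (position x)

    height*-1 : N.height ℤ.* -1ℤ ≡ - N.height
    height*-1 = trans (ℤₚ.*-comm N.height -1ℤ) (ℤₚ.-1*i≡-i N.height)

    position-port : ∀ v → position (port v) ≡ enlarge (F.position v)
    position-port 0F = trans N.position-c (cong₂ _,_ (sym (ℤₚ.*-zeroʳ N.width)) (sym height*-1))
    position-port 1F = trans N.position-d (cong₂ _,_ (sym (ℤₚ.*-zeroʳ N.width)) (sym (ℤₚ.*-identityʳ N.height)))
    position-port (suc (suc i)) = refl

    private instance
      height-pos : ℤ.Positive N.height
      height-pos = ℤ.positive N.0<height
      height-nonNeg : ℤ.NonNegative N.height
      height-nonNeg = ℤ.nonNegative (ℤₚ.<⇒≤ N.0<height)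
      width-nonNeg : ℤ.NonNegative N.width
      width-nonNeg = ℤ.nonNegative (ℤₚ.<⇒≤ N.0<width)

    y-port-mono : ∀ u v → F.y-of u ℤ.< F.y-of v → y-of (port u) ℤ.< y-of (port v)
    y-port-mono u v u<v = subst₂ ℤ._<_ (sym (cong proj₂ (position-port u))) (sym (cong proj₂ (position-port v)))
      (ℤₚ.*-monoˡ-<-pos N.height u<v)

    -height≡ : N.height ℤ.* (- F.height) ≡ - height
    -height≡ = sym (ℤₚ.neg-distribʳ-* N.height F.height)

    position-bottom : position (inj₁ F.bottom) ≡ (0ℤ , - height)
    position-bottom = trans (cong enlarge F′.bottom-place) (cong₂ _,_ (ℤₚ.*-zeroʳ N.width) -height≡)

    position-top : position (inj₁ F.top) ≡ (0ℤ , height)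
    position-top = trans (cong enlarge F′.top-place) (cong (_, height) (ℤₚ.*-zeroʳ N.width))

    -height<inner : ∀ x → - height ℤ.< N.y-of x
    -height<inner x = ℤₚ.<-≤-trans
      (subst₂ ℤ._<_ -height≡ height*-1 (ℤₚ.*-monoˡ-<-pos N.height (F′.lowest F.c λ ())))
      (N.-height≤y x)

    inner<height : ∀ x → N.y-of x ℤ.< height
    inner<height x = ℤₚ.≤-<-trans (N.y≤height x)
      (subst (ℤ._< height) (ℤₚ.*-identityʳ N.height) (ℤₚ.*-monoˡ-<-pos N.height (F′.highest F.d λ ())))

    lowest : ∀ x → x ≢ inj₁ F.bottom → - height ℤ.< y-of x
    lowest (inj₁ i) i≢ = subst (ℤ._< y-of (inj₁ i)) -height≡
      (ℤₚ.*-monoˡ-<-pos N.height (F′.lowest (ν i) λ { refl → i≢ refl }))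
    lowest (inj₂ x) _ = -height<inner x

    highest : ∀ x → x ≢ inj₁ F.top → y-of x ℤ.< height
    highest (inj₁ i) i≢ = ℤₚ.*-monoˡ-<-pos N.height (F′.highest (ν i) λ { refl → i≢ refl })
    highest (inj₂ x) _ = inner<height x

    ∣stretch∣ : ∀ {X x w} → .⦃ ℤ.NonNegative X ⦄ → + ∣ x ∣ ℤ.≤ w → + ∣ X ℤ.* x ∣ ℤ.≤ X ℤ.* w
    ∣stretch∣ {X} {x} {w} x≤w = begin
      + ∣ X ℤ.* x ∣           ≡⟨ cong +_ (ℤₚ.abs-* X x) ⟩
      + (∣ X ∣ ℕ.* ∣ x ∣)     ≡⟨ ℤₚ.pos-* (∣ X ∣) (∣ x ∣) ⟩
      + ∣ X ∣ ℤ.* + ∣ x ∣     ≡⟨ cong (ℤ._* + ∣ x ∣) (ℤₚ.0≤i⇒+∣i∣≡i (ℤₚ.nonNegative⁻¹ X)) ⟩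
      X ℤ.* + ∣ x ∣           ≤⟨ ℤₚ.*-monoˡ-≤-nonNeg X x≤w ⟩
      X ℤ.* w                 ∎
      where open ℤₚ.≤-Reasoning

    X≤X*w : ∀ X {w} → .⦃ ℤ.NonNegative X ⦄ → 0ℤ ℤ.< w → X ℤ.≤ X ℤ.* w
    X≤X*w X {w} 0<w = subst (ℤ._≤ X ℤ.* w) (ℤₚ.*-identityʳ X) (ℤₚ.*-monoˡ-≤-nonNeg X (ℤₚ.i<j⇒suc[i]≤j 0<w))

    inBox : ∀ x → InBox width height (position x)
    inBox (inj₁ i) = let x≤ , y≤ = F′.inBox (ν i) in ∣stretch∣ {N.width} x≤ , ∣stretch∣ {N.height} y≤
    inBox (inj₂ x) = let x≤ , y≤ = N.inBox x in
      ℤₚ.≤-trans x≤ (X≤X*w N.width F′.0<width) , ℤₚ.≤-trans y≤ (X≤X*w N.height F′.0<height)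

    outside : ∀ i x → position (inj₁ i) ≢ N.position x
    outside i x eq = let g , 0<g , g≤0 = F′.outside i in contradiction
      (value-stretch->0 g (lookup F.place i) 0<g)
      (ℤₚ.≤⇒≯ (subst (λ p → value (stretchForm N.width N.height g) p ℤ.≤ 0ℤ) (sym eq)
        (nonPositive-on-box g g≤0 (N.inBox x))))

    enlarge-injective : ∀ {p q} → enlarge p ≡ enlarge q → p ≡ q
    enlarge-injective {x , y} {x′ , y′} eq = cong₂ _,_
      (ℤₚ.*-cancelˡ-≡ N.width x x′ ⦃ ℤ.≢-nonZero (ℤₚ.<⇒≢ N.0<width ∘ sym) ⦄ (cong proj₁ eq))
      (ℤₚ.*-cancelˡ-≡ N.height y y′ ⦃ ℤ.≢-nonZero (ℤₚ.<⇒≢ N.0<height ∘ sym) ⦄ (cong proj₂ eq))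

    position-injective : ∀ {x y} → position x ≡ position y → x ≡ y
    position-injective {inj₁ i} {inj₁ j} eq with i Finₚ.≟ j
    ... | yes i≡j = cong inj₁ i≡j
    ... | no  i≢j = contradiction (enlarge-injective eq) (F′.distinct (ν i) (ν j) λ { refl → i≢j refl })
    position-injective {inj₁ i} {inj₂ y} eq = contradiction eq (outside i y)
    position-injective {inj₂ x} {inj₁ j} eq = contradiction (sym eq) (outside j x)
    position-injective {inj₂ x} {inj₂ y} eq = cong inj₂ (N.position-injective eq)

    upward : ∀ {x y} → x ≤ y → x ≢ y → y-of x ℤ.< y-of y
    upward {inj₁ i} {inj₁ j} i⊑j i≢j = y-port-mono (ν i) (ν j) (F′.⊑-upward (ν i) (ν j) i⊑j λ { refl → i≢j refl })
    upward {inj₁ i} {inj₂ y} (i⊑c , _) _ = ℤₚ.<-≤-trans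
      (subst (y-of (inj₁ i) ℤ.<_) (cong proj₂ N.position-c) (y-port-mono (ν i) F.c (F′.⊑-upward (ν i) F.c i⊑c λ ())))
      (N.-height≤y y)
    upward {inj₂ x} {inj₁ j} (_ , d⊑j) _ = ℤₚ.≤-<-trans (N.y≤height x)
      (subst (ℤ._< y-of (inj₁ j)) (cong proj₂ N.position-d) (y-port-mono F.d (ν j) (F′.⊑-upward F.d (ν j) d⊑j λ ())))
    upward {inj₂ x} {inj₂ y} x≤y x≢y = N.upward x≤y (x≢y ∘ cong inj₂)

    cover-upward : ∀ {x y} → x ⋖′ y → y-of x ℤ.< y-of y
    cover-upward {x} {y} (x≤y , x≢y , _) = upward {x} {y} x≤y x≢y

    y-c : y-of (inj₂ N.c) ≡ - N.height
    y-c = cong proj₂ N.position-c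

    y-d : y-of (inj₂ N.d) ≡ N.height
    y-d = cong proj₂ N.position-d

    value-c : value (heightForm N.height) (N.position N.c) ≡ 0ℤ
    value-c = trans (value-heightForm N.height (N.position N.c))
      (trans (cong (ℤ._+_ N.height) y-c) (ℤₚ.+-inverseʳ N.height))

    value-d : value (depthForm N.height) (N.position N.d) ≡ 0ℤ
    value-d = trans (value-depthForm N.height (N.position N.d))
      (trans (cong (λ y → N.height ℤ.- y) y-d) (ℤₚ.+-inverseʳ N.height))

    0<value-above-c : ∀ x → x ≢ N.c → 0ℤ ℤ.< value (heightForm N.height) (N.position x)
    0<value-above-c x x≢c = subst (0ℤ ℤ.<_) (sym (value-heightForm N.height (N.position x))) (-i<j⇒0<i+j (N.lowest x x≢c))

    0<value-below-d : ∀ x → x ≢ N.d → 0ℤ ℤ.< value (depthForm N.height) (N.position x)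
    0<value-below-d x x≢d = subst (0ℤ ℤ.<_) (sym (value-depthForm N.height (N.position x))) (j<i⇒0<i-j (N.highest x x≢d))

    value-below-c : ∀ x → x ⋖′ inj₂ N.c → value (heightForm N.height) (position x) ℤ.≤ 0ℤ
    value-below-c x x⋖c = subst (ℤ._≤ 0ℤ) (sym (value-heightForm N.height (position x)))
      (ℤₚ.<⇒≤ (j<-i⇒i+j<0 (subst (y-of x ℤ.<_) y-c (cover-upward x⋖c))))

    value-above-d : ∀ y → inj₂ N.d ⋖′ y → value (depthForm N.height) (position y) ℤ.≤ 0ℤ
    value-above-d y d⋖y = subst (ℤ._≤ 0ℤ) (sym (value-depthForm N.height (position y)))
      (ℤₚ.<⇒≤ (i<j⇒i-j<0 (subst (ℤ._< y-of y) y-d (cover-upward d⋖y))))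

    -- The horizontal line through `c` separates: the frame edge comes from below, and `c` is the
    -- only inner point on the line. The upper end `q` cannot be `c`, so the inner segment touches
    -- the line at most in its start.
    separates-below-c : ∀ x {p q} → x ⋖′ inj₂ N.c → _⋖_ N.poset p q →
      Separable (position x) (N.position N.c) (N.position p) (N.position q)
    separates-below-c x {p} {q} x⋖c (p≤q , p≢q , _) =
      heightForm N.height , value-below-c x x⋖c , ℤₚ.≤-reflexive value-c , meets
      where
      q≢c : q ≢ N.c
      q≢c refl = ℤₚ.<⇒≱ (N.upward p≤q p≢q) (subst (ℤ._≤ N.y-of p) (sym y-c) (N.-height≤y p))
      meets : Meets (heightForm N.height) (position x) (N.position N.c) (N.position p) (N.position q)
      meets with p N.≟ N.c
      ... | yes refl = inj₂ (inj₁ ((value-c , inj₂ refl) , 0<value-above-c q q≢c))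
      ... | no  p≢c  = inj₁ (0<value-above-c p p≢c , 0<value-above-c q q≢c)

    separates-above-d : ∀ y {p q} → inj₂ N.d ⋖′ y → _⋖_ N.poset p q →
      Separable (N.position N.d) (position y) (N.position p) (N.position q)
    separates-above-d y {p} {q} d⋖y (p≤q , p≢q , _) =
      depthForm N.height , ℤₚ.≤-reflexive value-d , value-above-d y d⋖y , meets
      where
      p≢d : p ≢ N.d
      p≢d refl = ℤₚ.<⇒≱ (N.upward p≤q p≢q) (subst (N.y-of q ℤ.≤_) (sym y-d) (N.y≤height q))
      meets : Meets (depthForm N.height) (N.position N.d) (position y) (N.position p) (N.position q)
      meets with q N.≟ N.d
      ... | yes refl = inj₂ (inj₂ (0<value-below-d p p≢d , (value-d , inj₁ refl)))
      ... | no  q≢d  = inj₁ (0<value-below-d p p≢d , 0<value-below-d q q≢d)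

    value-port-≤0 : ∀ g v → value g (F.position v) ℤ.≤ 0ℤ →
      value (stretchForm N.width N.height g) (position (port v)) ℤ.≤ 0ℤ
    value-port-≤0 g v ≤0 = subst (λ p → value (stretchForm N.width N.height g) p ℤ.≤ 0ℤ)
      (sym (position-port v)) (value-stretch-≤0 g (F.position v) ≤0)

    frame-inner : ∀ u v {p q} → port u ⋖′ port v → ∃[ k ] lookup F.edge k ≡ (u , v) → _⋖_ N.poset p q →
      Noncrossing (position (port u)) (position (port v)) (N.position p) (N.position q)
    frame-inner u v {p} {q} u⋖v (k , eq) p⋖q with v Finₚ.≟ F.c | u Finₚ.≟ F.d
    ... | yes refl | _        = inj₁ (separates-below-c (port u) u⋖v p⋖q)
    ... | no  _    | yes refl = inj₁ (separates-above-d (port v) u⋖v p⋖q)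
    ... | no  v≢c  | no  u≢d  =
      let g , gu≤0 , gv≤0 , 0<box = subst (λ (u , v) → v ≢ F.c → u ≢ F.d →
            ∃[ g ] (value g (F.position u) ℤ.≤ 0ℤ × value g (F.position v) ℤ.≤ 0ℤ × PositiveOnBox g)) eq (F′.around k) v≢c u≢d
      in inj₁ (stretchForm N.width N.height g , value-port-≤0 g u gu≤0 , value-port-≤0 g v gv≤0 ,
               inj₁ (positive-on-box g 0<box (N.inBox p) , positive-on-box g 0<box (N.inBox q)))

    frame-avoids-inner : ∀ u v e → port u ⋖′ port v → ∃[ k ] lookup F.edge k ≡ (u , v) →
      inj₂ e ≢ port u → inj₂ e ≢ port v → Avoids (position (port u)) (position (port v)) (N.position e)
    frame-avoids-inner u v e u⋖v (k , eq) e≢u e≢v with v Finₚ.≟ F.c | u Finₚ.≟ F.d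
    ... | yes refl | _        = heightForm N.height , value-below-c (port u) u⋖v , ℤₚ.≤-reflexive value-c ,
                                0<value-above-c e (e≢v ∘ cong inj₂)
    ... | no  _    | yes refl = depthForm N.height , ℤₚ.≤-reflexive value-d , value-above-d (port v) u⋖v ,
                                0<value-below-d e (e≢u ∘ cong inj₂)
    ... | no  v≢c  | no  u≢d  =
      let g , gu≤0 , gv≤0 , 0<box = subst (λ (u , v) → v ≢ F.c → u ≢ F.d →
            ∃[ g ] (value g (F.position u) ℤ.≤ 0ℤ × value g (F.position v) ℤ.≤ 0ℤ × PositiveOnBox g)) eq (F′.around k) v≢c u≢d
      in stretchForm N.width N.height g , value-port-≤0 g u gu≤0 , value-port-≤0 g v gv≤0 ,
         positive-on-box g 0<box (N.inBox e)

    frame-frame : ∀ k l → k ≢ l → let (u , v) = lookup F.edge k ; (u′ , v′) = lookup F.edge l in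
      Noncrossing (position (port u)) (position (port v)) (position (port u′)) (position (port v′))
    frame-frame k l k≢l
      rewrite position-port (proj₁ (lookup F.edge k)) | position-port (proj₂ (lookup F.edge k))
            | position-port (proj₁ (lookup F.edge l)) | position-port (proj₂ (lookup F.edge l)) =
      noncrossing-stretch _ _ _ _ (F′.noncrossing k l k≢l)

    noncrossing : ∀ {a b a′ b′} → a ⋖′ b → a′ ⋖′ b′ → (a , b) ≢ (a′ , b′) →
      Noncrossing (position a) (position b) (position a′) (position b′)
    noncrossing a⋖b a′⋖b′ = by-cover (cover a⋖b) (cover a′⋖b′) a⋖b a′⋖b′
      where
      by-cover : ∀ {a b a′ b′} → Cover a b → Cover a′ b′ → a ⋖′ b → a′ ⋖′ b′ → (a , b) ≢ (a′ , b′) →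
        Noncrossing (position a) (position b) (position a′) (position b′)
      by-cover (frame k) (frame l) _ _ ≢ = frame-frame k l λ { refl → ≢ refl }
      by-cover (frame k) (inner p⋖q) u⋖v _ _ = frame-inner _ _ u⋖v (k , refl) p⋖q
      by-cover (inner p⋖q) (frame l) _ u⋖v _ = Sum.swap (frame-inner _ _ u⋖v (l , refl) p⋖q)
      by-cover (inner p⋖q) (inner p⋖q′) _ _ ≢ = N.noncrossing p⋖q p⋖q′ λ { refl → ≢ refl }

    frame-avoids-port : ∀ k w → let (u , v) = lookup F.edge k in w ≢ u → w ≢ v →
      Avoids (position (port u)) (position (port v)) (position (port w))
    frame-avoids-port k w w≢u w≢v =
      let (u , v) = lookup F.edge k
          g , gu≤0 , gv≤0 , 0<gw = F′.avoiding k w w≢u w≢v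
      in stretchForm N.width N.height g , value-port-≤0 g u gu≤0 , value-port-≤0 g v gv≤0 ,
         subst (λ p → 0ℤ ℤ.< value (stretchForm N.width N.height g) p) (sym (position-port w))
           (value-stretch->0 g (F.position w) 0<gw)

    avoiding : ∀ {a b} e → a ⋖′ b → e ≢ a → e ≢ b → Avoids (position a) (position b) (position e)
    avoiding e a⋖b = by-cover e (cover a⋖b) a⋖b
      where
      by-cover : ∀ {a b} e → Cover a b → a ⋖′ b → e ≢ a → e ≢ b → Avoids (position a) (position b) (position e)
      by-cover (inj₁ i) (frame k)   _   e≢a e≢b = frame-avoids-port k (ν i) (e≢a ∘ cong port) (e≢b ∘ cong port)
      by-cover (inj₂ x) (frame k)   u⋖v e≢a e≢b = frame-avoids-inner _ _ x u⋖v (k , refl) e≢a e≢b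
      by-cover (inj₁ i) (inner {p} {q} _) _ _ _ =
        let g , 0<g , g≤0 = F′.outside i in
        stretchForm N.width N.height g , nonPositive-on-box g g≤0 (N.inBox p) ,
        nonPositive-on-box g g≤0 (N.inBox q) , value-stretch->0 g (lookup F.place i) 0<g
      by-cover (inj₂ x) (inner p⋖q) _ e≢a e≢b = N.avoiding x p⋖q (e≢a ∘ cong inj₂) (e≢b ∘ cong inj₂)

    -- Elements above c gain the s levels of the new chain below c; all others keep their rank,
    -- as only elements outside the inner poset are put above d.
    shifted : ∀ {A : Set} → Dec A → ℕ → ℕ
    shifted (yes _) r = s ℕ.+ r
    shifted (no _)  r = r

    offset : Bool → ℕ → ℕ
    offset false r = r
    offset true  r = h ℕ.+ r

    rank : Carrier → ℕ
    rank (inj₁ i) = offset (lookup F.high i) (lookup F.level i)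
    rank (inj₂ x) = shifted (N.c N.≤? x) (N.rank x)

    offset< : ∀ b {r} → r ℕ.< s → offset b r ℕ.< s ℕ.+ h
    offset< false {r} r<s = ℕₚ.<-≤-trans r<s (ℕₚ.m≤m+n s h)
    offset< true  {r} r<s = subst (h ℕ.+ r ℕ.<_) (ℕₚ.+-comm h s) (ℕₚ.+-monoʳ-< h r<s)

    rank< : ∀ x → rank x ℕ.< s ℕ.+ h
    rank< (inj₁ i) = offset< (lookup F.high i) (F′.level< i)
    rank< (inj₂ x) with N.c N.≤? x
    ... | yes _ = ℕₚ.+-monoʳ-< s (N.rank< x)
    ... | no  _ = ℕₚ.<-≤-trans (N.rank< x) (ℕₚ.m≤n+m h s)

    offset-mono : ∀ b {r t} → r ℕ.< t → offset b r ℕ.< offset b t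
    offset-mono false r<t = r<t
    offset-mono true  r<t = ℕₚ.+-monoʳ-< h r<t

    0<h : 0 ℕ.< h
    0<h = ℕₚ.≤-<-trans ℕ.z≤n (N.rank< N.c)

    rank-mono : ∀ {x y} → x ≤ y → x ≢ y → rank x ℕ.< rank y
    rank-mono {inj₁ i} {inj₁ j} i⊑j i≢j with F′.level-mono i j i⊑j (i≢j ∘ cong inj₁)
    ... | inj₁ (same , lt) rewrite same = offset-mono (lookup F.high j) lt
    -- Positivity of `h` makes up for levels that may be equal.
    ... | inj₂ (lowᵢ , highⱼ , le) rewrite lowᵢ | highⱼ = ℕₚ.+-mono-<-≤ 0<h le
    rank-mono {inj₁ i} {inj₂ y} (i⊑c , c≤y) _ rewrite F′.below-c i i⊑c with N.c N.≤? y
    ... | yes _   = ℕₚ.<-≤-trans (F′.level< i) (ℕₚ.m≤m+n s (N.rank y))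
    ... | no  c≰y = contradiction c≤y c≰y
    rank-mono {inj₂ x} {inj₁ j} (x≤d , d⊑j) _ rewrite F′.above-d j d⊑j with N.c N.≤? x
    -- An element below `d` is not above `c`, so its rank is not shifted and stays below `h`, where
    -- the high levels begin.
    ... | yes c≤x = contradiction (N≤.trans c≤x x≤d) N.c≰d
    ... | no  _   = ℕₚ.<-≤-trans (N.rank< x) (ℕₚ.m≤m+n h (lookup F.level j))
    rank-mono {inj₂ x} {inj₂ y} x≤y x≢y with N.c N.≤? x | N.c N.≤? y | N.rank-mono x≤y (x≢y ∘ cong inj₂)
    ... | yes _   | yes _   | lt = ℕₚ.+-monoʳ-< s lt
    ... | no  _   | no  _   | lt = lt
    ... | no  _   | yes _   | lt = ℕₚ.<-≤-trans lt (ℕₚ.m≤n+m (N.rank y) s)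
    ... | yes c≤x | no  c≰y | _  = contradiction (N≤.trans c≤x x≤y) c≰y

    spine⊎ : Fin s ⊎ Fin h → Carrier
    spine⊎ (inj₁ i) = inj₁ (lookup F.spine i)
    spine⊎ (inj₂ j) = inj₂ (N.spine j)

    spine⊎-injective : ∀ i j → spine⊎ i ≡ spine⊎ j → i ≡ j
    spine⊎-injective (inj₁ i) (inj₁ j) eq with i Finₚ.≟ j
    ... | yes i≡j = cong inj₁ i≡j
    ... | no  i≢j = contradiction (inj₁-injective eq) (F′.spine-distinct i j i≢j)
    spine⊎-injective (inj₂ i) (inj₂ j) eq = cong inj₂ (N.spine-injective (inj₂-injective eq))

    spine⊎-chain : ∀ i j → spine⊎ i ≤ spine⊎ j ⊎ spine⊎ j ≤ spine⊎ i
    spine⊎-chain (inj₁ i) (inj₁ j) = F′.spine-chain i j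
    spine⊎-chain (inj₁ i) (inj₂ j) = inj₁ (F′.spine⊑c i , N.c≤spine j)
    spine⊎-chain (inj₂ i) (inj₁ j) = inj₂ (F′.spine⊑c j , N.c≤spine i)
    spine⊎-chain (inj₂ i) (inj₂ j) = N.spine-chain i j

    bottom≤spine⊎ : ∀ i → inj₁ F.bottom ≤ spine⊎ i
    bottom≤spine⊎ (inj₁ i) = F′.bottom⊑spine i
    bottom≤spine⊎ (inj₂ i) = F′.bottom⊑c , N.c≤spine i

    low⊎ up⊎ : Fin m ⊎ Fin n → Carrier
    low⊎ (inj₁ i) = inj₁ (lookup F.lows i)
    low⊎ (inj₂ i) = inj₂ (N.low i)
    up⊎ (inj₁ i) = inj₁ (lookup F.ups i)
    up⊎ (inj₂ i) = inj₂ (N.up i)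

    low⊎≤top : ∀ i → low⊎ i ≤ inj₁ F.top
    low⊎≤top (inj₁ i) = F′.low⊑top i
    low⊎≤top (inj₂ i) = N.low≤d i , F′.d⊑top

    bottom≤up⊎ : ∀ i → inj₁ F.bottom ≤ up⊎ i
    bottom≤up⊎ (inj₁ i) = F′.bottom⊑up i
    bottom≤up⊎ (inj₂ i) = F′.bottom⊑c , N.c≤up i

    low⊎≤up⊎ : ∀ i j → i ≢ j → low⊎ i ≤ up⊎ j
    low⊎≤up⊎ (inj₁ i) (inj₁ j) i≢j = F′.low⊑up i j (i≢j ∘ cong inj₁)
    low⊎≤up⊎ (inj₁ i) (inj₂ j) _   = F′.low⊑c i , N.c≤up j
    low⊎≤up⊎ (inj₂ i) (inj₁ j) _   = N.low≤d i , F′.d⊑up j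
    low⊎≤up⊎ (inj₂ i) (inj₂ j) i≢j = N.low≤up i j (i≢j ∘ cong inj₂)

    low⊎≰up⊎ : ∀ i → ¬ low⊎ i ≤ up⊎ i
    low⊎≰up⊎ (inj₁ i) = F′.low⋢up i
    low⊎≰up⊎ (inj₂ i) = N.low≰up i

    surround : Nested (s ℕ.+ h) (m ℕ.+ n)
    surround = record
      { poset = poset
      ; _≤?_ = _≤?_
      ; c = inj₁ F.bottom
      ; d = inj₁ F.top
      ; position = position
      ; width = width
      ; height = height
      ; 0<width = 0<-* N.0<width F′.0<width
      ; 0<height = 0<-* N.0<height F′.0<height
      ; position-c = position-bottom
      ; position-d = position-top
      ; inBox = inBox
      ; lowest = lowest
      ; highest = highest
      ; position-injective = position-injective
      ; upward = λ {x} {y} → upward {x} {y}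
      ; c≰d = F′.bottom⋢top
      ; noncrossing = noncrossing
      ; avoiding = avoiding
      ; rank = rank
      ; rank< = rank<
      ; rank-mono = λ {x} {y} → rank-mono {x} {y}
      ; spine = λ i → spine⊎ (splitAt s i)
      ; spine-injective = λ {i} {j} eq → splitAt-injective s (spine⊎-injective (splitAt s i) (splitAt s j) eq)
      ; spine-chain = λ i j → spine⊎-chain (splitAt s i) (splitAt s j)
      ; c≤spine = λ i → bottom≤spine⊎ (splitAt s i)
      ; low = λ i → low⊎ (splitAt m i)
      ; up = λ i → up⊎ (splitAt m i)
      ; low≤d = λ i → low⊎≤top (splitAt m i)
      ; c≤up = λ i → bottom≤up⊎ (splitAt m i)
      ; low≤up = λ i j i≢j → low⊎≤up⊎ (splitAt m i) (splitAt m j) (i≢j ∘ splitAt-injective m)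
      ; low≰up = λ i → low⊎≰up⊎ (splitAt m i)
      }

  -- An antichain, because `c` must not be below `d`. It has no covers, so the conditions on
  -- crossings hold vacuously.
  twoPoints : Nested 1 0
  twoPoints = record
    { poset = record
      { Carrier        = Fin 2
      ; _≤_            = _≡_
      ; isPartialOrder = record
        { isPreorder = record { isEquivalence = isEquivalence ; reflexive = λ eq → eq ; trans = trans }
        ; antisym    = λ eq _ → eq
        }
      ; size           = 2
      ; enumeration    = ↔-id (Fin 2)
      }
    ; _≤?_ = Finₚ._≟_
    ; c = 0F
    ; d = 1F
    ; position = position
    ; width = 1ℤ
    ; height = 1ℤ
    ; 0<width = ℤ.+<+ (ℕ.s≤s ℕ.z≤n)
    ; 0<height = ℤ.+<+ (ℕ.s≤s ℕ.z≤n)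
    ; position-c = refl
    ; position-d = refl
    ; inBox = λ { 0F → ℤ.+≤+ ℕ.z≤n , ℤₚ.≤-refl ; 1F → ℤ.+≤+ ℕ.z≤n , ℤₚ.≤-refl }
    ; lowest = λ { 0F ≢ → contradiction refl ≢ ; 1F _ → ℤ.-<+ }
    ; highest = λ { 0F _ → ℤ.-<+ ; 1F ≢ → contradiction refl ≢ }
    ; position-injective = position-injective
    ; upward = λ x≡y x≢y → contradiction x≡y x≢y
    ; c≰d = λ ()
    ; noncrossing = λ (a≡b , a≢b , _) → contradiction a≡b a≢b
    ; avoiding = λ _ (a≡b , a≢b , _) → contradiction a≡b a≢b
    ; rank = λ _ → 0
    ; rank< = λ _ → ℕ.s≤s ℕ.z≤n
    ; rank-mono = λ x≡y x≢y → contradiction x≡y x≢y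
    ; spine = λ _ → 0F
    ; spine-injective = λ { {0F} {0F} _ → refl }
    ; spine-chain = λ _ _ → inj₁ refl
    ; c≤spine = λ _ → refl
    ; low = λ ()
    ; up = λ ()
    ; low≤d = λ ()
    ; c≤up = λ ()
    ; low≤up = λ ()
    ; low≰up = λ ()
    }
    where
    position : Fin 2 → ℤ²
    position 0F = 0ℤ , -1ℤ
    position 1F = 0ℤ , 1ℤ
    position-injective : ∀ {x y} → position x ≡ position y → x ≡ y
    position-injective {0F} {0F} _ = refl
    position-injective {1F} {1F} _ = refl
    position-injective {0F} {1F} ()
    position-injective {1F} {0F} ()

-- Planarity, height and dimension of nested drawings, and the count

module Construction where
  open Reals
  open Plane
  open Posets
  open Frames
  open Nesting
  open import Data.Nat.Base as ℕ using (ℕ; suc)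
  import Data.Nat.Properties as ℕₚ
  open import Data.Integer.Base as ℤ using (+_)
  import Data.Integer.Properties as ℤₚ
  open import Data.Rational.Base as ℚ using (_/_; _*_; _-_; _≤_)
  import Data.Rational.Properties as ℚₚ
  import Data.Rational.Unnormalised.Base as ℚᵘ
  import Data.Rational.Unnormalised.Properties as ℚᵘₚ
  open import Data.Product using (∃-syntax; _×_; _,_; proj₁; proj₂)
  open import Data.Sum.Base as Sum using (_⊎_; inj₁; inj₂)
  open import Relation.Binary.PropositionalEquality using (_≡_; _≢_; refl; trans; cong; cong₂; subst₂)
  open import Relation.Nullary.Decidable using (yes; no)
  open import Relation.Nullary.Negation using (contradiction)
  open import Data.Nat.Tactic.RingSolver using (solve-∀)
  open import Data.Integer.Tactic.RingSolver using () renaming (solve-∀ to ℤ-solve-∀)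

  module _ {h m} (N : Nested h m) where
    open Nested N

    nested-planar : Planar poset
    nested-planar = diagram , record
      { meet-at-common-endpoint = meet
      ; avoid-other-points      = avoid
      }
      where
      diagram : Diagram poset
      diagram = record
        { point          = λ x → pointℝ (position x)
        ; point-distinct = λ eq → position-injective (pointℝ-injective eq)
        ; curve          = λ a b → segment (position a) (position b)
        ; curve-upward   = λ a b (a≤b , a≢b , _) → segment-upward (position a) (position b) (upward a≤b a≢b)
        }

      meet-separable : ∀ a b a′ b′ → Separable (position a) (position b) (position a′) (position b′) → ∀ s t →
        segment (position a) (position b) s ≈ℝ² segment (position a′) (position b′) t →
        ∃[ e ] ((e ≡ a ⊎ e ≡ b) × (e ≡ a′ ⊎ e ≡ b′) × segment (position a′) (position b′) t ≈ℝ² pointℝ (position e))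
      meet-separable a b a′ b′ (g , separates) s t eq = Sum.[
          (λ (at-a′ , shared) → a′ , Sum.map position-injective position-injective shared , inj₁ refl , at-a′) ,
          (λ (at-b′ , shared) → b′ , Sum.map position-injective position-injective shared , inj₂ refl , at-b′) ]′
        (segments-meet g (position a) (position b) (position a′) (position b′) separates s t eq)

      meet : ∀ a b a′ b′ → _⋖_ poset a b → _⋖_ poset a′ b′ → (a , b) ≢ (a′ , b′) → ∀ s t →
        segment (position a) (position b) s ≈ℝ² segment (position a′) (position b′) t →
        ∃[ e ] ((e ≡ a ⊎ e ≡ b) × (e ≡ a′ ⊎ e ≡ b′) × segment (position a) (position b) s ≈ℝ² pointℝ (position e))
      meet a b a′ b′ a⋖b a′⋖b′ distinct s t eq = Sum.[
          (λ sep → let e , ∈ab , ∈a′b′ , at-e = meet-separable a b a′ b′ sep s t eq in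
            e , ∈ab , ∈a′b′ , ≈ℝ²-trans (segment (position a) (position b) s)
              (segment (position a′) (position b′) t) (pointℝ (position e)) eq at-e) ,
          (λ sep → let e , ∈a′b′ , ∈ab , at-e = meet-separable a′ b′ a b sep t s
                         (≈ℝ²-sym (segment (position a) (position b) s) (segment (position a′) (position b′) t) eq) in
            e , ∈ab , ∈a′b′ , at-e) ]′
        (noncrossing a⋖b a′⋖b′ distinct)

      avoid : ∀ a b → _⋖_ poset a b → ∀ e s → segment (position a) (position b) s ≈ℝ² pointℝ (position e) → e ≡ a ⊎ e ≡ b
      avoid a b a⋖b e s at-e with e ≟ a | e ≟ b
      ... | yes e≡a | _       = inj₁ e≡a
      ... | no  _   | yes e≡b = inj₂ e≡b
      ... | no  e≢a | no  e≢b = contradiction at-e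
        (segment-avoids (position a) (position b) (position e) (avoiding e a⋖b e≢a e≢b) s)

    nested-height : HasHeight poset h
    nested-height = (spine , spine-injective , spine-chain) , rank⇒chain≤ poset rank rank< rank-mono

    nested-dimension : ∃[ d ] (HasDimension poset d × m ℕ.≤ d)
    nested-dimension =
      let d , isDimension = Dimension.dimension poset _≤?_ (λ x → proj₂ (position x)) (λ x → proj₁ (position x))
                              (λ y≡ x≡ → position-injective (cong₂ _,_ x≡ y≡)) upward
      in d , isDimension , standard-example⇒dimension≥ poset low up low≤up low≰up d (proj₁ isDimension)

  -- One base case for each residue modulo 3. The slack in the inequality is 2, 1, 0 at heights 1,
  -- 2, 3, and a double frame adds 12 to both sides.
  nested : ∀ h → ∃[ m ] (Nested (suc h) m × 4 ℕ.* suc h ℕ.≤ 3 ℕ.* m ℕ.+ 6)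
  nested 0 = 0 , twoPoints , ℕₚ.m≤m+n 4 2
  nested 1 = 1 , Surround.surround kellyFrame-isFrame twoPoints , ℕₚ.m≤m+n 8 1
  nested 2 = 2 , Surround.surround kellyFrame-isFrame (Surround.surround kellyFrame-isFrame twoPoints) , ℕₚ.≤-refl
  nested (suc (suc (suc h))) =
    let m , N , bound = nested h in
    4 ℕ.+ m , Surround.surround doubleFrame-isFrame N ,
    subst₂ ℕ._≤_ (left h) (right m) (ℕₚ.+-monoʳ-≤ 12 bound)
    where
    left : ∀ h → 12 ℕ.+ 4 ℕ.* (1 ℕ.+ h) ≡ 4 ℕ.* (4 ℕ.+ h)
    left = solve-∀
    right : ∀ m → 12 ℕ.+ (3 ℕ.* m ℕ.+ 6) ≡ 3 ℕ.* (4 ℕ.+ m) ℕ.+ 6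
    right = solve-∀

  -- In unnormalised fractions the inequality is a cross multiplication with the denominators 3 and
  -- 1, which is the integer inequality with 6 subtracted from both sides.
  4h≤3d+6⇒4/3h-2≤d : ∀ h d → 4 ℕ.* h ℕ.≤ 3 ℕ.* d ℕ.+ 6 → (+ 4 / 3) * (+ h / 1) - (+ 2 / 1) ≤ + d / 1
  4h≤3d+6⇒4/3h-2≤d h d 4h≤3d+6 = ℚₚ.toℚᵘ-cancel-≤ (begin
    ℚ.toℚᵘ ((+ 4 / 3) * (+ h / 1) - (+ 2 / 1))
      ≃⟨ ℚₚ.toℚᵘ-homo-+ ((+ 4 / 3) * (+ h / 1)) (ℚ.- (+ 2 / 1)) ⟩
    ℚ.toℚᵘ ((+ 4 / 3) * (+ h / 1)) ℚᵘ.- ℚᵘ.mkℚᵘ (+ 2) 0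
      ≃⟨ ℚᵘₚ.+-congˡ (ℚᵘ.- ℚᵘ.mkℚᵘ (+ 2) 0) (ℚᵘₚ.≃-trans (ℚₚ.toℚᵘ-homo-* (+ 4 / 3) (+ h / 1))
           (ℚᵘₚ.*-congˡ {ℚᵘ.mkℚᵘ (+ 4) 2} (ℚₚ.toℚᵘ-fromℚᵘ (ℚᵘ.mkℚᵘ (+ h) 0)))) ⟩
    ℚᵘ.mkℚᵘ (+ 4) 2 ℚᵘ.* ℚᵘ.mkℚᵘ (+ h) 0 ℚᵘ.- ℚᵘ.mkℚᵘ (+ 2) 0
      ≤⟨ ℚᵘ.*≤* (subst₂ ℤ._≤_ (left (+ h)) (right (+ d)) (ℤₚ.+-monoˡ-≤ (ℤ.- + 6) 4h≤3d+6′)) ⟩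
    ℚᵘ.mkℚᵘ (+ d) 0
      ≃⟨ ℚₚ.toℚᵘ-fromℚᵘ (ℚᵘ.mkℚᵘ (+ d) 0) ⟨
    ℚ.toℚᵘ (+ d / 1) ∎)
    where
    open ℚᵘₚ.≤-Reasoning
    4h≤3d+6′ : + 4 ℤ.* + h ℤ.≤ + 3 ℤ.* + d ℤ.+ + 6
    4h≤3d+6′ = subst₂ ℤ._≤_ (ℤₚ.pos-* 4 h)
      (trans (ℤₚ.pos-+ (3 ℕ.* d) 6) (cong (ℤ._+ + 6) (ℤₚ.pos-* 3 d))) (ℤ.+≤+ 4h≤3d+6)
    left : ∀ a → + 4 ℤ.* a ℤ.- + 6 ≡ (+ 4 ℤ.* a ℤ.* + 1 ℤ.+ ℤ.- + 2 ℤ.* + 3) ℤ.* + 1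
    left = ℤ-solve-∀
    right : ∀ b → + 3 ℤ.* b ℤ.+ + 6 ℤ.- + 6 ≡ b ℤ.* + 3
    right = ℤ-solve-∀

open import Data.Nat.Base using (ℕ; suc; _≥_)
import Data.Nat.Properties as ℕₚ
open import Data.Integer.Base using (+_)
open import Data.Rational.Base using (_/_; _*_; _-_; _≤_)
open import Data.Product using (Σ-syntax; ∃-syntax; _×_; _,_)
open Nesting using (Nested)
open Construction

theorem2 : ∀ (h : ℕ) → h ≥ 1 →
    Σ[ P ∈ FinitePoset ]
    (Planar P × HasHeight P h ×
    (∃[ d ] (HasDimension P d × (+ 4 / 3) * (+ h / 1) - (+ 2 / 1) ≤ + d / 1)))
theorem2 (suc h) _ =
  let m , N , bound       = nested h
      d , isDim , m≤d     = nested-dimension N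
  in Nested.poset N , nested-planar N , nested-height N , d , isDim ,
     4h≤3d+6⇒4/3h-2≤d (suc h) d (ℕₚ.≤-trans bound (ℕₚ.+-monoˡ-≤ 6 (ℕₚ.*-monoʳ-≤ 3 m≤d)))
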